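{- For any constant $\epsilon>0$, any randomized online algorithm for online bipartite matching in the random edge arrival model that does not know the number of edges to arrive has competitive ratio at most $\frac23+\epsilon$.
   Context: Online bipartite matching in the random edge arrival model: the edges of a fixed bipartite graph arrive one at a time in a uniformly random order; upon each arrival the algorithm irrevocably decides whether to add the edge to its matching, which must remain a matching. Here the algorithm is not told the total number of edges. The competitive ratio is the infimum over graphs of (expected size of the output matching over the order and the algorithm's coins)$/|\textsc{OPT}|$, with $\textsc{OPT}$ a maximum matching. -}

module Defs where

open import Data.Bool using (Bool; if_then_else_)
open import Data.Fin using (Fin)
open import Data.Integer using (+_)
open import Data.List using (List; []; _∷_; _++_; map; concatMap; filter; length)
open import Data.List.Extrema.Nat using (max)
open import Data.List.Relation.Unary.Unique.Propositional using (Unique)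
import Data.Fin as Fin
import Data.List.Relation.Unary.Unique.DecPropositional as DecUnique
open import Data.Nat using (ℕ; NonZero; _!)
open import Data.Nat.ListAction using (sum)
import Data.Nat as ℕ
import Data.Nat.Properties as ℕₚ
open import Data.Product using (∃-syntax; _×_; _,_; proj₁; proj₂)
open import Data.Rational using (ℚ; 0ℚ; 1ℚ; ½; ∣_∣; 1/_; _/_; Positive)
import Data.Rational as ℚ
import Data.Rational.Properties as ℚₚ
open import Data.Rational.Solver using (module +-*-Solver)
open import Data.Vec.Functional using (Vector; foldr)
open import Function using (_∘_)
open import Relation.Binary.PropositionalEquality using (_≡_; refl; sym; trans; cong; subst)
open import Relation.Nullary.Decidable using (Dec; _×-dec_)

------------------------------------------------------------------------
-- Cauchy real numbers

IsCauchy : (ℕ → ℚ) → Set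
IsCauchy x = ∀ δ → 0ℚ ℚ.< δ →
  ∃[ N ] (∀ m n → N ℕ.≤ m → N ℕ.≤ n → ∣ x m ℚ.- x n ∣ ℚ.≤ δ)

record ℝ : Set where
  constructor real
  field
    seq    : ℕ → ℚ
    cauchy : IsCauchy seq

open ℝ public

infix  4 _≤_ _<_ _≃_
infixl 6 _+_
infixr 7 _·_

_≤_ : ℝ → ℝ → Set
x ≤ y = ∀ δ → 0ℚ ℚ.< δ →
  ∃[ N ] (∀ n → N ℕ.≤ n → seq x n ℚ.≤ seq y n ℚ.+ δ)

_<_ : ℝ → ℝ → Set
x < y = ∃[ δ ] (0ℚ ℚ.< δ ×
  ∃[ N ] (∀ n → N ℕ.≤ n → seq x n ℚ.+ δ ℚ.≤ seq y n))

_≃_ : ℝ → ℝ → Set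
x ≃ y = x ≤ y × y ≤ x

private
  abstract
    constant-cauchy : ∀ q → IsCauchy (λ _ → q)
    constant-cauchy q δ 0<δ = 0 , λ _ _ _ _ →
      subst (ℚ._≤ δ) (sym (cong ∣_∣ (ℚₚ.+-inverseʳ q))) (ℚₚ.<⇒≤ 0<δ)

fromℚ : ℚ → ℝ
fromℚ q = real (λ _ → q) (constant-cauchy q)

0ℝ 1ℝ : ℝ
0ℝ = fromℚ 0ℚ
1ℝ = fromℚ 1ℚ

private
  open ℚₚ.≤-Reasoning
  open +-*-Solver using (solve; _:=_; _:+_; _:-_; _:*_; con)

  half-pos : ∀ {δ} → 0ℚ ℚ.< δ → 0ℚ ℚ.< ½ ℚ.* δ
  half-pos {δ} 0<δ = subst (ℚ._< ½ ℚ.* δ) (ℚₚ.*-zeroʳ ½) (ℚₚ.*-monoʳ-<-pos ½ 0<δ)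

  halves : ∀ δ → ½ ℚ.* δ ℚ.+ ½ ℚ.* δ ≡ δ
  halves = solve 1 (λ δ → con ½ :* δ :+ con ½ :* δ := δ) refl

  regroup : ∀ a b c d → (a ℚ.+ b) ℚ.- (c ℚ.+ d) ≡ (a ℚ.- c) ℚ.+ (b ℚ.- d)
  regroup = solve 4 (λ a b c d → (a :+ b) :- (c :+ d) := (a :- c) :+ (b :- d)) refl

  +-close : ∀ a b c d η → ∣ a ℚ.- c ∣ ℚ.≤ η → ∣ b ℚ.- d ∣ ℚ.≤ η →
    ∣ (a ℚ.+ b) ℚ.- (c ℚ.+ d) ∣ ℚ.≤ η ℚ.+ η
  +-close a b c d η a≈c b≈d = begin
    ∣ (a ℚ.+ b) ℚ.- (c ℚ.+ d) ∣     ≡⟨ cong ∣_∣ (regroup a b c d) ⟩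
    ∣ (a ℚ.- c) ℚ.+ (b ℚ.- d) ∣     ≤⟨ ℚₚ.∣p+q∣≤∣p∣+∣q∣ (a ℚ.- c) (b ℚ.- d) ⟩
    ∣ a ℚ.- c ∣ ℚ.+ ∣ b ℚ.- d ∣     ≤⟨ ℚₚ.+-mono-≤ a≈c b≈d ⟩
    η ℚ.+ η                         ∎

  factor : ∀ a b c → a ℚ.* b ℚ.- a ℚ.* c ≡ a ℚ.* (b ℚ.- c)
  factor = solve 3 (λ a b c → a :* b :- a :* c := a :* (b :- c)) refl

  ∣p∣≤∣p∣+1 : ∀ p → ∣ p ∣ ℚ.≤ ∣ p ∣ ℚ.+ 1ℚ
  ∣p∣≤∣p∣+1 p = subst (ℚ._≤ ∣ p ∣ ℚ.+ 1ℚ) (ℚₚ.+-identityʳ ∣ p ∣)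
    (ℚₚ.+-monoʳ-≤ ∣ p ∣ (ℚₚ.<⇒≤ (ℚₚ.positive⁻¹ 1ℚ)))

  ∣p∣+1-pos : ∀ p → Positive (∣ p ∣ ℚ.+ 1ℚ)
  ∣p∣+1-pos p = ℚₚ.nonNeg+pos⇒pos ∣ p ∣ {{ℚₚ.∣-∣-nonNeg p}} 1ℚ

  divide : ∀ K → Positive K → ∀ δ → 0ℚ ℚ.< δ → ∃[ η ] (0ℚ ℚ.< η × K ℚ.* η ≡ δ)
  divide K K-pos δ 0<δ = 1/K ℚ.* δ , 0<1/K*δ , K*[1/K*δ]≡δ
    where
    instance
      K-nonZero : ℚ.NonZero K
      K-nonZero = ℚₚ.pos⇒nonZero K {{K-pos}}
    1/K : ℚ
    1/K = 1/ K
    0<1/K*δ : 0ℚ ℚ.< 1/K ℚ.* δ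
    0<1/K*δ = subst (ℚ._< 1/K ℚ.* δ) (ℚₚ.*-zeroʳ 1/K)
      (ℚₚ.*-monoʳ-<-pos 1/K {{ℚₚ.1/pos⇒pos K {{K-pos}}}} 0<δ)
    K*[1/K*δ]≡δ : K ℚ.* (1/K ℚ.* δ) ≡ δ
    K*[1/K*δ]≡δ = trans (sym (ℚₚ.*-assoc K 1/K δ))
      (trans (cong (ℚ._* δ) (ℚₚ.*-inverseʳ K)) (ℚₚ.*-identityˡ δ))

  ·-close : ∀ q b c K η → ∣ q ∣ ℚ.≤ K → Positive K → ∣ b ℚ.- c ∣ ℚ.≤ η →
    ∣ q ℚ.* b ℚ.- q ℚ.* c ∣ ℚ.≤ K ℚ.* η
  ·-close q b c K η ∣q∣≤K K-pos b≈c = begin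
    ∣ q ℚ.* b ℚ.- q ℚ.* c ∣   ≡⟨ cong ∣_∣ (factor q b c) ⟩
    ∣ q ℚ.* (b ℚ.- c) ∣       ≡⟨ ℚₚ.∣p*q∣≡∣p∣*∣q∣ q (b ℚ.- c) ⟩
    ∣ q ∣ ℚ.* ∣ b ℚ.- c ∣     ≤⟨ ℚₚ.*-monoʳ-≤-nonNeg ∣ b ℚ.- c ∣ {{ℚₚ.∣-∣-nonNeg (b ℚ.- c)}} ∣q∣≤K ⟩
    K ℚ.* ∣ b ℚ.- c ∣         ≤⟨ ℚₚ.*-monoˡ-≤-nonNeg K {{ℚₚ.pos⇒nonNeg K {{K-pos}}}} b≈c ⟩
    K ℚ.* η                   ∎

  abstract
    +-cauchy : ∀ {x y} → IsCauchy x → IsCauchy y → IsCauchy (λ n → x n ℚ.+ y n)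
    +-cauchy {x} {y} x-cauchy y-cauchy δ 0<δ =
      let M , close-x = x-cauchy (½ ℚ.* δ) (half-pos 0<δ)
          N , close-y = y-cauchy (½ ℚ.* δ) (half-pos 0<δ)
      in M ℕ.⊔ N , λ m n m≥ n≥ →
        subst (∣ (x m ℚ.+ y m) ℚ.- (x n ℚ.+ y n) ∣ ℚ.≤_) (halves δ)
          (+-close (x m) (y m) (x n) (y n) (½ ℚ.* δ)
            (close-x m n (ℕₚ.m⊔n≤o⇒m≤o M N m≥) (ℕₚ.m⊔n≤o⇒m≤o M N n≥))
            (close-y m n (ℕₚ.m⊔n≤o⇒n≤o M N m≥) (ℕₚ.m⊔n≤o⇒n≤o M N n≥)))

    ·-cauchy : ∀ q {x} → IsCauchy x → IsCauchy (λ n → q ℚ.* x n)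
    ·-cauchy q {x} x-cauchy δ 0<δ =
      let K = ∣ q ∣ ℚ.+ 1ℚ
          η , 0<η , Kη≡δ = divide K (∣p∣+1-pos q) δ 0<δ
          N , close-x = x-cauchy η 0<η
      in N , λ m n m≥ n≥ →
        subst (∣ q ℚ.* x m ℚ.- q ℚ.* x n ∣ ℚ.≤_) Kη≡δ
          (·-close q (x m) (x n) K η (∣p∣≤∣p∣+1 q) (∣p∣+1-pos q) (close-x m n m≥ n≥))

_+_ : ℝ → ℝ → ℝ
x + y = real (λ n → seq x n ℚ.+ seq y n) (+-cauchy {seq x} {seq y} (cauchy x) (cauchy y))

_·_ : ℚ → ℝ → ℝ
q · x = real (λ n → q ℚ.* seq x n) (·-cauchy q {seq x} (cauchy x))

Σℝ : ∀ {k} → Vector ℝ k → ℝ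
Σℝ = foldr _+_ 0ℝ

------------------------------------------------------------------------
-- Bipartite graphs and matchings

Edge : ℕ → ℕ → Set
Edge l r = Fin l × Fin r

record BipartiteGraph (l r : ℕ) : Set where
  field
    edges    : List (Edge l r)
    distinct : Unique edges

open BipartiteGraph public

module _ {l r : ℕ} where

  IsMatching : List (Edge l r) → Set
  IsMatching M = Unique (map proj₁ M) × Unique (map proj₂ M)

  isMatching? : (M : List (Edge l r)) → Dec (IsMatching M)
  isMatching? M =
    DecUnique.unique? Fin._≟_ (map proj₁ M) ×-dec DecUnique.unique? Fin._≟_ (map proj₂ M)

sublists : ∀ {A : Set} → List A → List (List A)
sublists []       = [] ∷ []
sublists (x ∷ xs) = map (x ∷_) (sublists xs) ++ sublists xs

∣OPT∣ : ∀ {l r} → BipartiteGraph l r → ℕ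
∣OPT∣ G = max 0 (map length (filter isMatching? (sublists (edges G))))

------------------------------------------------------------------------
-- Online algorithms

-- `insertions x xs` puts x at each of the positions of xs, so that
-- `permutations xs` lists each of the (length xs)! orders exactly once
-- when the entries of xs are distinct.
insertions : ∀ {A : Set} → A → List A → List (List A)
insertions x []       = (x ∷ []) ∷ []
insertions x (y ∷ ys) = (x ∷ y ∷ ys) ∷ map (y ∷_) (insertions x ys)

permutations : ∀ {A : Set} → List A → List (List A)
permutations []       = [] ∷ []
permutations (x ∷ xs) = concatMap (insertions x) (permutations xs)

-- Arrival sequences are written with the most recent edge first. In
-- `accept past e` the edge e arrives after those of past; the earlier
-- decisions are not an argument since past determines them.
output : ∀ {l r} → (List (Edge l r) → Edge l r → Bool) → List (Edge l r) → List (Edge l r)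
output accept []         = []
output accept (e ∷ past) =
  if accept past e then e ∷ output accept past else output accept past

record DeterministicAlgorithm (l r : ℕ) : Set where
  field
    accept : List (Edge l r) → Edge l r → Bool
    valid  : ∀ {arrivals} → Unique arrivals → IsMatching (output accept arrivals)

open DeterministicAlgorithm public

-- A probability distribution over deterministic algorithms. Finitely many
-- coin outcomes with arbitrary real probabilities lose no generality: for
-- given l and r there are only finitely many sequences of distinct edges,
-- hence only finitely many distinguishable deterministic algorithms.
record RandomizedStrategy (l r : ℕ) : Set where
  field
    outcomes    : ℕ
    probability : Vector ℝ outcomes
    nonNegative : ∀ i → 0ℝ ≤ probability i
    total       : Σℝ probability ≃ 1ℝ
    strategy    : Vector (DeterministicAlgorithm l r) outcomes

open RandomizedStrategy public

-- The two vertex sets may be known in advance, but the number of edges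
-- that will arrive may not.
RandomizedAlgorithm : Set
RandomizedAlgorithm = ∀ l r → RandomizedStrategy l r

module _ {l r : ℕ} where

  meanSize : DeterministicAlgorithm l r → BipartiteGraph l r → ℚ
  meanSize D G =
    (+ sum (map (length ∘ output (accept D)) (permutations (edges G)))) / (m !)
    where
    m = length (edges G)
    instance
      m!≢0 : NonZero (m !)
      m!≢0 = m ℕₚ.!≢0

  expectedSize : RandomizedAlgorithm → BipartiteGraph l r → ℝ
  expectedSize A G = Σℝ λ i → meanSize (strategy (A l r) i) G · probability (A l r) i

  ratio : RandomizedAlgorithm → (G : BipartiteGraph l r) → .{{NonZero (∣OPT∣ G)}} → ℝ
  ratio A G = (+ 1 / ∣OPT∣ G) · expectedSize A G

-- The infimum of the ratios over all graphs is at most x, that is, every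
-- lower bound of the ratios is. (As a number the infimum need not be
-- constructible.) Graphs without edges have no ratio.
CompetitiveRatio_AtMost_ : RandomizedAlgorithm → ℝ → Set
CompetitiveRatio A AtMost x =
  ∀ c → (∀ {l r} (G : BipartiteGraph l r) .{{_ : NonZero (∣OPT∣ G)}} → c ≤ ratio A G) → c ≤ x

{-# OPTIONS --safe #-}
module Submission where

-- The hard instance is the "thick Z": a complete bipartite graph between n left
-- and n right central vertices, together with a pendant edge at each of the 2n
-- central vertices. Its optimum is the set of all 2n pendant edges, and since
-- every edge covers a central vertex and central edges cover two, a matching
-- with x central edges has size at most 2n - x.
--
-- Stop the random order after a small constant fraction of its edges. The
-- arrived graph is itself a graph on which the algorithm has to be competitive:
-- it contains few pendant edges, yet a greedy matching shows that it has a
-- nearly perfect matching of the central vertices, of size about n. So an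
-- algorithm with ratio c accepts about c n central edges by then and ends with
-- at most about (2 - c) n edges on the thick Z, whence 2c ≤ 2 - c.
--
-- Averaging over all prefixes and over the whole graph at once (the easy half of
-- Yao's principle) reduces this to an inequality for each deterministic
-- algorithm, proved by counting over arrangements (sequences without repetition).

open import Defs hiding (_≤_; _<_; _+_)
open import Data.Bool using (Bool; true; false; if_then_else_)
open import Data.Fin as Fin using (Fin; zero; suc; toℕ; fromℕ<; _↑ˡ_; opposite)
import Data.Fin.Properties as Finₚ
open import Data.List using (List; []; _∷_; _++_; map; concatMap; filter; foldr; length; drop; allFin; cartesianProduct)
open import Data.List.Extrema.Nat using (max; xs≤max)
import Data.List.Membership.DecPropositional as DecMembership
open import Data.List.Membership.Propositional using (_∈_; _∉_; find)
open import Data.List.Membership.Propositional.Properties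
import Data.List.Properties as Listₚ
open import Data.List.Relation.Binary.Permutation.Propositional using (_↭_; prep; swap; ↭-refl; ↭-sym; ↭-trans)
open import Data.List.Relation.Binary.Permutation.Propositional.Properties using (∈-resp-↭)
open import Data.List.Relation.Binary.Subset.Propositional using (_⊆_)
open import Data.List.Relation.Unary.All as All using (All; []; _∷_)
import Data.List.Relation.Unary.All.Properties as Allₚ
open import Data.List.Relation.Unary.Any using (here; there)
open import Data.List.Relation.Unary.Unique.Propositional using (Unique; []; _∷_)
import Data.List.Relation.Unary.Unique.Propositional.Properties as Uniqueₚ
open import Data.Nat as ℕ using (ℕ; zero; suc; NonZero)
open import Data.Nat.ListAction using (sum)
open import Data.Nat.ListAction.Properties using (sum-++)
import Data.Nat.Properties as ℕₚ
open import Data.Nat.Tactic.RingSolver using (solve-∀)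
open import Data.Product using (∃-syntax; _×_; _,_; proj₁; proj₂)
open import Data.Product.Properties using (≡-dec)
open import Data.Sum using (inj₁; inj₂)
open import Data.Vec.Functional using (Vector; tail)
open import Function using (_∘_)
open import Relation.Binary using (DecidableEquality)
open import Relation.Binary.PropositionalEquality
open import Relation.Nullary using (¬_; Dec; yes; no; does; ¬?; _×-dec_; contradiction)
open import Relation.Unary using (Decidable)

module Counting where

  open import Data.Nat hiding (_≟_)
  open import Data.Nat.Properties hiding (_≟_)

  -- Finite sums of natural numbers over lists.

  module Sums where

    ∑ : ∀ {A : Set} → List A → (A → ℕ) → ℕ
    ∑ xs f = sum (map f xs)

    syntax ∑ xs (λ x → e) = ∑[ x ∈ xs ] e

    ⟦_⟧ : ∀ {P : Set} → Dec P → ℕ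
    ⟦ yes _ ⟧ = 1
    ⟦ no _ ⟧  = 0

    module _ {A : Set} where

      ∑-cong : ∀ {f g : A → ℕ} xs → (∀ x → x ∈ xs → f x ≡ g x) → ∑ xs f ≡ ∑ xs g
      ∑-cong []       h = refl
      ∑-cong (x ∷ xs) h = cong₂ _+_ (h x (here refl)) (∑-cong xs λ y y∈ → h y (there y∈))

      ∑-mono : ∀ {f g : A → ℕ} xs → (∀ x → x ∈ xs → f x ≤ g x) → ∑ xs f ≤ ∑ xs g
      ∑-mono []       h = z≤n
      ∑-mono (x ∷ xs) h = +-mono-≤ (h x (here refl)) (∑-mono xs λ y y∈ → h y (there y∈))

      ∑-+ : ∀ (f g : A → ℕ) xs → ∑[ x ∈ xs ] (f x + g x) ≡ ∑ xs f + ∑ xs g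
      ∑-+ f g []       = refl
      ∑-+ f g (x ∷ xs) = trans (cong (f x + g x +_) (∑-+ f g xs)) (interchange (f x) (g x) _ _)
        where
        interchange : ∀ a b c d → a + b + (c + d) ≡ a + c + (b + d)
        interchange = solve-∀

      ∑-*ˡ : ∀ k (f : A → ℕ) xs → ∑[ x ∈ xs ] (k * f x) ≡ k * ∑ xs f
      ∑-*ˡ k f []       = sym (*-zeroʳ k)
      ∑-*ˡ k f (x ∷ xs) = trans (cong (k * f x +_) (∑-*ˡ k f xs)) (sym (*-distribˡ-+ k (f x) _))

      ∑-*ʳ : ∀ k (f : A → ℕ) xs → ∑[ x ∈ xs ] (f x * k) ≡ ∑ xs f * k
      ∑-*ʳ k f []       = refl
      ∑-*ʳ k f (x ∷ xs) = trans (cong (f x * k +_) (∑-*ʳ k f xs)) (sym (*-distribʳ-+ k (f x) _))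

      ∑-const : ∀ k (xs : List A) → ∑[ x ∈ xs ] k ≡ length xs * k
      ∑-const k []       = refl
      ∑-const k (x ∷ xs) = cong (k +_) (∑-const k xs)

      ∑-length : ∀ (xs : List A) → ∑[ x ∈ xs ] 1 ≡ length xs
      ∑-length xs = trans (∑-const 1 xs) (*-identityʳ _)

      ∑-++ : ∀ (f : A → ℕ) xs ys → ∑ (xs ++ ys) f ≡ ∑ xs f + ∑ ys f
      ∑-++ f xs ys = trans (cong sum (Listₚ.map-++ f xs ys)) (sum-++ (map f xs) (map f ys))

      ∑-filter : ∀ {P : A → Set} (P? : Decidable P) (f : A → ℕ) xs →
        ∑ (filter P? xs) f ≡ ∑[ x ∈ xs ] (if does (P? x) then f x else 0)
      ∑-filter P? f []       = refl
      ∑-filter P? f (x ∷ xs) with does (P? x)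
      ... | true  = cong (f x +_) (∑-filter P? f xs)
      ... | false = ∑-filter P? f xs

      ∑-⟦⟧ : ∀ {P : A → Set} (P? : Decidable P) xs → ∑[ x ∈ xs ] ⟦ P? x ⟧ ≡ length (filter P? xs)
      ∑-⟦⟧ P? []       = refl
      ∑-⟦⟧ P? (x ∷ xs) with P? x
      ... | yes _ = cong suc (∑-⟦⟧ P? xs)
      ... | no _  = ∑-⟦⟧ P? xs

    module _ {A B : Set} where

      ∑-map : ∀ (g : A → B) (f : B → ℕ) xs → ∑ (map g xs) f ≡ ∑[ x ∈ xs ] f (g x)
      ∑-map g f xs = cong sum (sym (Listₚ.map-∘ xs))

      ∑-concatMap : ∀ (h : A → List B) (f : B → ℕ) xs →
        ∑ (concatMap h xs) f ≡ ∑[ x ∈ xs ] ∑ (h x) f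
      ∑-concatMap h f []       = refl
      ∑-concatMap h f (x ∷ xs) =
        trans (∑-++ f (h x) _) (cong (∑ (h x) f +_) (∑-concatMap h f xs))

      ∑-comm : ∀ (f : A → B → ℕ) xs ys →
        ∑[ x ∈ xs ] ∑[ y ∈ ys ] f x y ≡ ∑[ y ∈ ys ] ∑[ x ∈ xs ] f x y
      ∑-comm f []       ys = sym (trans (∑-const 0 ys) (*-zeroʳ (length ys)))
      ∑-comm f (x ∷ xs) ys =
        trans (cong (∑ ys (f x) +_) (∑-comm f xs ys)) (sym (∑-+ (f x) _ ys))

    module _ {A B : Set} where

      ∑-cartesianProduct : ∀ (f : A × B → ℕ) xs ys →
        ∑ (cartesianProduct xs ys) f ≡ ∑[ x ∈ xs ] ∑[ y ∈ ys ] f (x , y)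
      ∑-cartesianProduct f []       ys = refl
      ∑-cartesianProduct f (x ∷ xs) ys =
        trans (∑-++ f (map (x ,_) ys) _)
          (cong₂ _+_ (∑-map (x ,_) f ys) (∑-cartesianProduct f xs ys))

  open Sums

  -- Lengths of lists without repetition.

  module Uniqueness {A : Set} where

    -- Pigeonhole: the head of `xs` is cut out of `ys`, and since it does not recur in `xs`, the
    -- tail still fits into what is left.
    Unique⇒length≤ : ∀ {xs ys : List A} → Unique xs → xs ⊆ ys → length xs ≤ length ys
    Unique⇒length≤ [] _ = z≤n
    Unique⇒length≤ {x ∷ xs} {ys} (x∉xs ∷ u) sub with ∈-∃++ (sub (here refl))
    ... | as , bs , refl = begin
      suc (length xs)               ≤⟨ s≤s (Unique⇒length≤ u shrink) ⟩
      suc (length (as ++ bs))       ≡⟨ cong suc (Listₚ.length-++ as) ⟩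
      suc (length as + length bs)   ≡⟨ sym (+-suc (length as) (length bs)) ⟩
      length as + suc (length bs)   ≡⟨ sym (Listₚ.length-++ as) ⟩
      length (as ++ x ∷ bs)         ∎
      where
      open ≤-Reasoning
      shrink : xs ⊆ as ++ bs
      shrink {y} y∈ with ∈-++⁻ as (sub (there y∈))
      ... | inj₁ y∈as         = ∈-++⁺ˡ y∈as
      ... | inj₂ (here refl)  = contradiction refl (All.lookup x∉xs y∈)
      ... | inj₂ (there y∈bs) = ∈-++⁺ʳ as y∈bs

    length-filter-split : ∀ {P : A → Set} (P? : Decidable P) (xs : List A) →
      length (filter P? xs) + length (filter (¬? ∘ P?) xs) ≡ length xs
    length-filter-split P? []       = refl
    length-filter-split P? (x ∷ xs) with does (P? x)
    ... | true  = cong suc (length-filter-split P? xs)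
    ... | false = trans (+-suc _ _) (cong suc (length-filter-split P? xs))

    module _ (_∈?_ : ∀ (x : A) (xs : List A) → Dec (x ∈ xs)) where

      -- Here `ys` may repeat entries and contain strangers to `xs`. In this form the lemma counts
      -- the central vertices that a matching leaves free.
      length-removal-≥ : ∀ {xs} (ys : List A) → Unique xs →
        length xs ≤ length ys + length (filter (λ x → ¬? (x ∈? ys)) xs)
      length-removal-≥ {xs} ys u = begin
        length xs
          ≡⟨ sym (length-filter-split (_∈? ys) xs) ⟩
        length (filter (_∈? ys) xs) + _
          ≤⟨ +-monoˡ-≤ _ (Unique⇒length≤ (Uniqueₚ.filter⁺ (_∈? ys) u) (λ x∈ → proj₂ (∈-filter⁻ (_∈? ys) {xs = xs} x∈))) ⟩
        length ys + _ ∎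
        where open ≤-Reasoning

      length-removal : ∀ {xs ys} → Unique xs → Unique ys → ys ⊆ xs →
        length ys + length (filter (λ x → ¬? (x ∈? ys)) xs) ≡ length xs
      length-removal {xs} {ys} u v sub = ≤-antisym
        (begin
          length ys + _ ≤⟨ +-monoˡ-≤ _ (Unique⇒length≤ v (λ y∈ → ∈-filter⁺ (_∈? ys) (sub y∈) y∈)) ⟩
          length (filter (_∈? ys) xs) + _ ≡⟨ length-filter-split (_∈? ys) xs ⟩
          length xs ∎)
        (length-removal-≥ ys u)
        where open ≤-Reasoning

  open Uniqueness

  -- Insertions and permutations as rearrangements.

  module Permutations {A : Set} where

    insertions-↭ : ∀ (x : A) ys {zs} → zs ∈ insertions x ys → zs ↭ x ∷ ys
    insertions-↭ x []       (here refl) = ↭-refl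
    insertions-↭ x (y ∷ ys) (here refl) = ↭-refl
    insertions-↭ x (y ∷ ys) (there zs∈) with ∈-map⁻ (y ∷_) zs∈
    ... | ws , ws∈ , refl = ↭-trans (prep y (insertions-↭ x ys ws∈)) (swap y x ↭-refl)

    permutations-↭ : ∀ (xs : List A) {zs} → zs ∈ permutations xs → zs ↭ xs
    permutations-↭ []       (here refl) = ↭-refl
    permutations-↭ (x ∷ xs) zs∈ with find (∈-concatMap⁻ (insertions x) zs∈)
    ... | ws , ws∈ , zs∈′ = ↭-trans (insertions-↭ x ws zs∈′) (prep x (permutations-↭ xs ws∈))

  open Permutations

  -- Counting over arrangements: uniformly random orders and their prefixes.

  module Arrangements {A : Set} (_≟_ : DecidableEquality A) (E : List A) where

    open DecMembership _≟_ using (_∈?_)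

    m : ℕ
    m = length E

    avail : List A → List A
    avail past = filter (λ e → ¬? (e ∈? past)) E

    -- The arrival sequences of length t, most recent entry first, so that
    -- `drop d σ` is what had arrived d steps before σ.
    Seq : ℕ → List (List A)
    Seq zero    = [] ∷ []
    Seq (suc t) = concatMap (λ past → map (_∷ past) (avail past)) (Seq t)

    ∑-Seq-suc : ∀ t (φ : List A → ℕ) →
      ∑ (Seq (suc t)) φ ≡ ∑[ past ∈ Seq t ] ∑[ e ∈ avail past ] φ (e ∷ past)
    ∑-Seq-suc t φ = trans (∑-concatMap _ φ (Seq t))
      (∑-cong (Seq t) λ past _ → ∑-map (_∷ past) φ (avail past))

    avail-↭ : ∀ {σ τ} → σ ↭ τ → avail σ ≡ avail τ
    avail-↭ p = Listₚ.filter-≐ _ _ ((_∘ ∈-resp-↭ (↭-sym p)) , (_∘ ∈-resp-↭ p)) E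

    private
      -- The guards need not agree one by one. Equivalence of the two conjunctions suffices, because
      -- the value is 0 unless both guards pass.
      guard-swap : ∀ {P Q R S : Set} (P? : Dec P) (Q? : Dec Q) (R? : Dec R) (S? : Dec S) →
        (P → Q → R × S) → (R → S → P × Q) → ∀ k →
        (if does P? then (if does Q? then k else 0) else 0) ≡
        (if does R? then (if does S? then k else 0) else 0)
      guard-swap (yes p) (yes q) (yes r) (yes s) f g k = refl
      guard-swap (yes p) (yes q) (yes r) (no ¬s) f g k = contradiction (proj₂ (f p q)) ¬s
      guard-swap (yes p) (yes q) (no ¬r) S?      f g k = contradiction (proj₁ (f p q)) ¬r
      guard-swap (yes p) (no ¬q) (yes r) (yes s) f g k = contradiction (proj₂ (g r s)) ¬q
      guard-swap (no ¬p) Q?      (yes r) (yes s) f g k = contradiction (proj₁ (g r s)) ¬p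
      guard-swap (yes p) (no ¬q) (yes r) (no ¬s) f g k = refl
      guard-swap (yes p) (no ¬q) (no ¬r) S?      f g k = refl
      guard-swap (no ¬p) Q?      (yes r) (no ¬s) f g k = refl
      guard-swap (no ¬p) Q?      (no ¬r) S?      f g k = refl

      ∉-swap : ∀ {x y : A} {ys} → y ∉ ys → x ∉ y ∷ ys → x ∉ ys × y ∉ x ∷ ys
      ∉-swap y∉ x∉ = x∉ ∘ there , λ { (here refl) → x∉ (here refl) ; (there y∈) → y∉ y∈ }

    -- Both sides run over the pairs of different edges outside `ys`. Written as guarded sums over
    -- all of `E`, they differ only in the order of summation.
    ∑-avail-swap : ∀ (h : A → A → ℕ) ys →
      ∑[ y ∈ avail ys ] ∑[ x ∈ avail (y ∷ ys) ] h y x ≡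
      ∑[ x ∈ avail ys ] ∑[ y ∈ avail (x ∷ ys) ] h y x
    ∑-avail-swap h ys = begin
      ∑[ y ∈ avail ys ] ∑[ x ∈ avail (y ∷ ys) ] h y x
        ≡⟨ guarded h ⟩
      ∑[ y ∈ E ] ∑[ x ∈ E ] (if does (¬? (y ∈? ys)) then (if does (¬? (x ∈? (y ∷ ys))) then h y x else 0) else 0)
        ≡⟨ ∑-comm _ E E ⟩
      ∑[ x ∈ E ] ∑[ y ∈ E ] (if does (¬? (y ∈? ys)) then (if does (¬? (x ∈? (y ∷ ys))) then h y x else 0) else 0)
        ≡⟨ ∑-cong E (λ x _ → ∑-cong E λ y _ →
             guard-swap (¬? (y ∈? ys)) (¬? (x ∈? (y ∷ ys))) (¬? (x ∈? ys)) (¬? (y ∈? (x ∷ ys))) ∉-swap ∉-swap (h y x)) ⟩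
      ∑[ x ∈ E ] ∑[ y ∈ E ] (if does (¬? (x ∈? ys)) then (if does (¬? (y ∈? (x ∷ ys))) then h y x else 0) else 0)
        ≡⟨ sym (guarded λ x y → h y x) ⟩
      ∑[ x ∈ avail ys ] ∑[ y ∈ avail (x ∷ ys) ] h y x ∎
      where
      open ≡-Reasoning
      pull : ∀ {P : Set} (P? : Dec P) (f : A → ℕ) →
        (if does P? then ∑ E f else 0) ≡ ∑[ x ∈ E ] (if does P? then f x else 0)
      pull P? f with does P?
      ... | true  = refl
      ... | false = sym (trans (∑-const 0 E) (*-zeroʳ (length E)))
      guarded : ∀ (h : A → A → ℕ) →
        ∑[ y ∈ avail ys ] ∑[ x ∈ avail (y ∷ ys) ] h y x ≡
        ∑[ y ∈ E ] ∑[ x ∈ E ] (if does (¬? (y ∈? ys)) then (if does (¬? (x ∈? (y ∷ ys))) then h y x else 0) else 0)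
      guarded h = trans (∑-filter _ _ E) (∑-cong E λ y _ →
        trans (cong (λ k → if does (¬? (y ∈? ys)) then k else 0) (∑-filter _ (h y) E))
              (pull (¬? (y ∈? ys)) _))

    -- Double counting: a sequence of length `suc t` arises once for each of the `suc t` positions
    -- that the inserted entry can have in it. The induction separates insertion at the front, which
    -- yields one copy of the sum, from insertion further back.
    ∑-insertions : ∀ t (φ : List A → ℕ) →
      ∑[ xs ∈ Seq t ] ∑[ x ∈ avail xs ] ∑ (insertions x xs) φ ≡ suc t * ∑ (Seq (suc t)) φ
    ∑-insertions zero φ = begin
      ∑[ x ∈ avail [] ] (φ (x ∷ []) + 0) + 0
        ≡⟨ cong (_+ 0) (∑-cong (avail []) λ x _ → +-identityʳ _) ⟩
      ∑[ x ∈ avail [] ] φ (x ∷ []) + 0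
        ≡⟨ sym (∑-Seq-suc 0 φ) ⟩
      ∑ (Seq 1) φ
        ≡⟨ sym (+-identityʳ _) ⟩
      1 * ∑ (Seq 1) φ ∎
      where open ≡-Reasoning
    ∑-insertions (suc t) φ = begin
      ∑[ xs ∈ Seq (suc t) ] ∑[ x ∈ avail xs ] ∑ (insertions x xs) φ
        ≡⟨ ∑-Seq-suc t _ ⟩
      ∑[ ys ∈ Seq t ] ∑[ y ∈ avail ys ] ∑[ x ∈ avail (y ∷ ys) ] (φ (x ∷ y ∷ ys) + ∑ (map (y ∷_) (insertions x ys)) φ)
        ≡⟨ (∑-cong (Seq t) λ ys _ → trans (∑-cong (avail ys) λ y _ → ∑-+ _ _ (avail (y ∷ ys))) (∑-+ _ _ (avail ys))) ⟩
      ∑[ ys ∈ Seq t ] (∑[ y ∈ avail ys ] ∑[ x ∈ avail (y ∷ ys) ] φ (x ∷ y ∷ ys)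
                     + ∑[ y ∈ avail ys ] ∑[ x ∈ avail (y ∷ ys) ] ∑ (map (y ∷_) (insertions x ys)) φ)
        ≡⟨ ∑-+ _ _ (Seq t) ⟩
      ∑[ ys ∈ Seq t ] ∑[ y ∈ avail ys ] ∑[ x ∈ avail (y ∷ ys) ] φ (x ∷ y ∷ ys)
        + ∑[ ys ∈ Seq t ] ∑[ y ∈ avail ys ] ∑[ x ∈ avail (y ∷ ys) ] ∑ (map (y ∷_) (insertions x ys)) φ
        ≡⟨ cong₂ _+_ (sym (trans (∑-Seq-suc (suc t) φ) (∑-Seq-suc t _))) (∑-cong (Seq t) λ ys _ → later ys) ⟩
      ∑ (Seq (2 + t)) φ + ∑[ ys ∈ Seq t ] ∑[ x ∈ avail ys ] ∑ (insertions x ys) Ψ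
        ≡⟨ cong (∑ (Seq (2 + t)) φ +_) (trans (∑-insertions t Ψ) (cong (suc t *_) (sym (∑-Seq-suc (suc t) φ)))) ⟩
      suc (suc t) * ∑ (Seq (2 + t)) φ ∎
      where
      open ≡-Reasoning
      Ψ : List A → ℕ
      Ψ zs = ∑[ y ∈ avail zs ] φ (y ∷ zs)
      -- Inserting `x` below the newest entry `y` amounts to inserting `x` first and letting `y`
      -- arrive afterwards: which `y` are possible depends only on the set of edges present, not on
      -- their order.
      later : ∀ ys → ∑[ y ∈ avail ys ] ∑[ x ∈ avail (y ∷ ys) ] ∑ (map (y ∷_) (insertions x ys)) φ
        ≡ ∑[ x ∈ avail ys ] ∑ (insertions x ys) Ψ
      later ys = trans (∑-avail-swap _ ys) (∑-cong (avail ys) λ x _ →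
        trans (∑-cong (avail (x ∷ ys)) λ y _ → ∑-map (y ∷_) φ (insertions x ys))
        (trans (∑-comm _ (avail (x ∷ ys)) (insertions x ys))
        (∑-cong (insertions x ys) λ zs zs∈ →
          cong (λ ws → ∑[ y ∈ ws ] φ (y ∷ zs)) (sym (avail-↭ (insertions-↭ x ys zs∈))))))

    -- A random permutation of a uniformly random arrangement is again a uniformly random
    -- arrangement. This removes the inner average over arrival orders once the graph itself is the
    -- edge set of a random arrangement.
    ∑-permutations : ∀ t (φ : List A → ℕ) →
      ∑[ σ ∈ Seq t ] ∑ (permutations σ) φ ≡ t ! * ∑ (Seq t) φ
    ∑-permutations zero    φ = refl
    ∑-permutations (suc t) φ = begin
      ∑[ σ ∈ Seq (suc t) ] ∑ (permutations σ) φ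
        ≡⟨ ∑-Seq-suc t _ ⟩
      ∑[ xs ∈ Seq t ] ∑[ x ∈ avail xs ] ∑ (concatMap (insertions x) (permutations xs)) φ
        ≡⟨ ∑-cong (Seq t) (λ xs _ →
             trans (∑-cong (avail xs) λ x _ → ∑-concatMap (insertions x) φ (permutations xs))
             (trans (∑-comm _ (avail xs) (permutations xs))
             (∑-cong (permutations xs) λ τ τ∈ →
               cong (λ ws → ∑[ x ∈ ws ] ∑ (insertions x τ) φ) (sym (avail-↭ (permutations-↭ xs τ∈)))))) ⟩
      ∑[ xs ∈ Seq t ] ∑[ τ ∈ permutations xs ] ∑[ x ∈ avail τ ] ∑ (insertions x τ) φ
        ≡⟨ ∑-permutations t _ ⟩
      t ! * ∑[ xs ∈ Seq t ] ∑[ x ∈ avail xs ] ∑ (insertions x xs) φ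
        ≡⟨ cong (t ! *_) (∑-insertions t φ) ⟩
      t ! * (suc t * ∑ (Seq (suc t)) φ)
        ≡⟨ rearrange (t !) (suc t) _ ⟩
      suc t ! * ∑ (Seq (suc t)) φ ∎
      where
      open ≡-Reasoning
      rearrange : ∀ a b c → a * (b * c) ≡ b * a * c
      rearrange = solve-∀

    record IsArrangement (t : ℕ) (σ : List A) : Set where
      field
        unique : Unique σ
        ⊆E     : σ ⊆ E
        size   : length σ ≡ t

    open IsArrangement public

    Seq⇒IsArrangement : ∀ t {σ} → σ ∈ Seq t → IsArrangement t σ
    Seq⇒IsArrangement zero    (here refl) = record { unique = [] ; ⊆E = λ () ; size = refl }
    Seq⇒IsArrangement (suc t) σ∈ with find (∈-concatMap⁻ (λ past → map (_∷ past) (avail past)) {xs = Seq t} σ∈)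
    ... | past , past∈ , σ∈′ with ∈-map⁻ (_∷ past) σ∈′
    ... | e , e∈ , refl with ∈-filter⁻ (λ e → ¬? (e ∈? past)) {xs = E} e∈ | Seq⇒IsArrangement t past∈
    ... | e∈E , e∉past | arr = record
      { unique = Allₚ.¬Any⇒All¬ past e∉past ∷ unique arr
      ; ⊆E     = λ { (here refl) → e∈E ; (there x∈) → ⊆E arr x∈ }
      ; size   = cong suc (size arr) }

    module _ (E-unique : Unique E) where

      length-avail : ∀ t {σ} → σ ∈ Seq t → t + length (avail σ) ≡ m
      length-avail t {σ} σ∈ = subst (λ k → k + length (avail σ) ≡ m) (size arr)
        (length-removal _∈?_ E-unique (unique arr) (⊆E arr))
        where
        arr = Seq⇒IsArrangement t σ∈

      length-avail-∸ : ∀ t {σ} → σ ∈ Seq t → length (avail σ) ≡ m ∸ t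
      length-avail-∸ t {σ} σ∈ = sym (trans (cong (_∸ t) (sym (length-avail t σ∈))) (m+n∸m≡n t _))

      -- All sequences of length `t` have the same number of continuations, so forgetting the newest
      -- edge only contributes a constant factor.
      ∑-Seq-tail : ∀ t (φ : List A → ℕ) →
        ∑[ past ∈ Seq t ] ∑[ e ∈ avail past ] φ past ≡ (m ∸ t) * ∑ (Seq t) φ
      ∑-Seq-tail t φ = trans
        (∑-cong (Seq t) λ past past∈ →
          trans (∑-const (φ past) (avail past)) (cong (_* φ past) (length-avail-∸ t past∈)))
        (∑-*ˡ (m ∸ t) φ (Seq t))

      length-Seq-suc : ∀ t → length (Seq (suc t)) ≡ (m ∸ t) * length (Seq t)
      length-Seq-suc t = begin
        length (Seq (suc t))               ≡⟨ sym (∑-length (Seq (suc t))) ⟩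
        ∑[ σ ∈ Seq (suc t) ] 1             ≡⟨ ∑-Seq-suc t _ ⟩
        ∑[ σ ∈ Seq t ] ∑[ e ∈ avail σ ] 1  ≡⟨ ∑-Seq-tail t _ ⟩
        (m ∸ t) * ∑[ σ ∈ Seq t ] 1         ≡⟨ cong ((m ∸ t) *_) (∑-length (Seq t)) ⟩
        (m ∸ t) * length (Seq t)           ∎
        where open ≡-Reasoning

      -- A falling factorial: the number of ways in which `d` more edges can arrive after the first
      -- `t`.
      extensions : ℕ → ℕ → ℕ
      extensions zero    t = 1
      extensions (suc d) t = (m ∸ (d + t)) * extensions d t

      -- A prefix of a uniformly random arrangement is itself uniformly random.
      ∑-Seq-drop : ∀ d t (φ : List A → ℕ) →
        ∑[ σ ∈ Seq (d + t) ] φ (drop d σ) ≡ extensions d t * ∑ (Seq t) φ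
      ∑-Seq-drop zero    t φ = sym (+-identityʳ _)
      ∑-Seq-drop (suc d) t φ = begin
        ∑[ σ ∈ Seq (suc d + t) ] φ (drop (suc d) σ)
          ≡⟨ ∑-Seq-suc (d + t) _ ⟩
        ∑[ past ∈ Seq (d + t) ] ∑[ e ∈ avail past ] φ (drop d past)
          ≡⟨ ∑-Seq-tail (d + t) _ ⟩
        (m ∸ (d + t)) * ∑[ past ∈ Seq (d + t) ] φ (drop d past)
          ≡⟨ cong ((m ∸ (d + t)) *_) (∑-Seq-drop d t φ) ⟩
        (m ∸ (d + t)) * (extensions d t * ∑ (Seq t) φ)
          ≡⟨ sym (*-assoc (m ∸ (d + t)) _ _) ⟩
        extensions (suc d) t * ∑ (Seq t) φ ∎
        where open ≡-Reasoning

      Seq-drop : ∀ d t {σ} → σ ∈ Seq (d + t) → drop d σ ∈ Seq t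
      Seq-drop zero    t σ∈ = σ∈
      Seq-drop (suc d) t σ∈ with find (∈-concatMap⁻ (λ past → map (_∷ past) (avail past)) {xs = Seq (d + t)} σ∈)
      ... | past , past∈ , σ∈′ with ∈-map⁻ (_∷ past) σ∈′
      ... | e , e∈ , refl = Seq-drop d t past∈

      length-Seq-pos : ∀ t → t ≤ m → 0 < length (Seq t)
      length-Seq-pos zero    _   = s≤s z≤n
      length-Seq-pos (suc t) t<m = subst (0 <_) (sym (length-Seq-suc t))
        (*-mono-≤ (m<n⇒0<n∸m t<m) (length-Seq-pos t (≤-trans (n≤1+n t) t<m)))

  -- Sublists, optimal matchings and greedy matchings.

  module Sublists {A : Set} where

    ∷∈sublists : ∀ (x : A) xs {M} → M ∈ sublists xs → x ∷ M ∈ sublists (x ∷ xs)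
    ∷∈sublists x xs M∈ = ∈-++⁺ˡ (∈-map⁺ (x ∷_) M∈)

    skip∈sublists : ∀ (x : A) xs {M} → M ∈ sublists xs → M ∈ sublists (x ∷ xs)
    skip∈sublists x xs M∈ = ∈-++⁺ʳ (map (x ∷_) (sublists xs)) M∈

    []∈sublists : ∀ (xs : List A) → [] ∈ sublists xs
    []∈sublists []       = here refl
    []∈sublists (x ∷ xs) = skip∈sublists x xs ([]∈sublists xs)

    filter∈sublists : ∀ {P : A → Set} (P? : Decidable P) xs → filter P? xs ∈ sublists xs
    filter∈sublists P? []       = here refl
    filter∈sublists P? (x ∷ xs) with does (P? x)
    ... | true  = ∷∈sublists x xs (filter∈sublists P? xs)
    ... | false = skip∈sublists x xs (filter∈sublists P? xs)

  open Sublists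

  module Matchings {l r : ℕ} where

    outputSize : DeterministicAlgorithm l r → List (Edge l r) → ℕ
    outputSize D σ = length (output (accept D) σ)

    -- This is `∣OPT∣` for a bare edge list. It agrees by definition with `∣OPT∣` of any graph with
    -- edges `σ`, so that every arrived prefix can serve as an instance.
    optimum : List (Edge l r) → ℕ
    optimum σ = max 0 (map length (filter isMatching? (sublists σ)))

    length≤optimum : ∀ (σ : List (Edge l r)) {M} → M ∈ sublists σ → IsMatching M → length M ≤ optimum σ
    length≤optimum σ M∈ matching = All.lookup (xs≤max 0 _)
      (∈-map⁺ length (∈-filter⁺ isMatching? M∈ matching))

    optimum-nonempty : ∀ e (σ : List (Edge l r)) → 1 ≤ optimum (e ∷ σ)
    optimum-nonempty e σ = length≤optimum (e ∷ σ) (∷∈sublists e σ ([]∈sublists σ)) ([] ∷ [] , [] ∷ [])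

    module Greedy {F : Edge l r → Set} (F? : Decidable F) where

      private
        module ∈ₗ = DecMembership (Fin._≟_ {l})
        module ∈ᵣ = DecMembership (Fin._≟_ {r})

      Free : Edge l r → List (Edge l r) → Set
      Free e M = proj₁ e ∉ map proj₁ M × proj₂ e ∉ map proj₂ M

      free? : ∀ e M → Dec (Free e M)
      free? e M = ¬? (proj₁ e ∈ₗ.∈? map proj₁ M) ×-dec ¬? (proj₂ e ∈ᵣ.∈? map proj₂ M)

      extend : ∀ {P : Set} → Dec P → Edge l r → List (Edge l r) → List (Edge l r)
      extend (yes _) e M = e ∷ M
      extend (no _)  e M = M

      greedy : List (Edge l r) → List (Edge l r)

      accepts? : ∀ past e → Dec (F e × Free e (greedy past))
      accepts? past e = F? e ×-dec free? e (greedy past)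

      greedy []         = []
      greedy (e ∷ past) = extend (accepts? past e) e (greedy past)

      greedy-matching : ∀ σ → IsMatching (greedy σ)
      greedy-matching []         = [] , []
      greedy-matching (e ∷ past) with accepts? past e | greedy-matching past
      ... | yes (_ , free₁ , free₂) | u , v = Allₚ.¬Any⇒All¬ _ free₁ ∷ u , Allₚ.¬Any⇒All¬ _ free₂ ∷ v
      ... | no _                    | u , v = u , v

      greedy∈sublists : ∀ σ → greedy σ ∈ sublists σ
      greedy∈sublists []         = here refl
      greedy∈sublists (e ∷ past) with accepts? past e
      ... | yes _ = ∷∈sublists e past (greedy∈sublists past)
      ... | no _  = skip∈sublists e past (greedy∈sublists past)

      greedy-F : ∀ σ → All F (greedy σ)
      greedy-F []         = []
      greedy-F (e ∷ past) with accepts? past e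
      ... | yes (f , _) = f ∷ greedy-F past
      ... | no _        = greedy-F past

      -- The greedy matching only grows, so an edge that is free at the end was free when it arrived
      -- and would have been taken then.
      greedy-maximal : ∀ σ {e} → F e → Free e (greedy σ) → e ∉ σ
      greedy-maximal (x ∷ past) f free e∈ with accepts? past x | e∈
      ... | yes _ | here refl = proj₁ free (here refl)
      ... | yes _ | there e∈′ = greedy-maximal past f (proj₁ free ∘ there , proj₂ free ∘ there) e∈′
      ... | no ¬a | here refl = ¬a (f , free)
      ... | no _  | there e∈′ = greedy-maximal past f free e∈′

      length-greedy-∷ : ∀ past e →
        length (greedy (e ∷ past)) ≡ length (greedy past) + ⟦ accepts? past e ⟧
      length-greedy-∷ past e with accepts? past e
      ... | yes _ = +-comm 1 _
      ... | no _  = sym (+-identityʳ _)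

  open Matchings

  -- The thick Z.

  unique-map : ∀ {A B : Set} (f : A → B) {xs} →
    (∀ {x y} → x ∈ xs → y ∈ xs → f x ≡ f y → x ≡ y) → Unique xs → Unique (map f xs)
  unique-map f inj []        = []
  unique-map f inj (x∉ ∷ u) =
    Allₚ.map⁺ (All.tabulate λ y∈ eq → All.lookup x∉ y∈ (inj (here refl) (there y∈) eq))
    ∷ unique-map f (λ x∈ y∈ → inj (there x∈) (there y∈)) u

  -- On either side the central vertices are the first n of 2n; `opposite` then
  -- matches central vertices with non-central ones.
  module ThickZ (n : ℕ) where

    V : Set
    V = Fin (n + n)

    Low : V → Set
    Low v = toℕ v < n

    low? : ∀ v → Dec (Low v)
    low? v = toℕ v <? n

    lows : List V
    lows = map (_↑ˡ n) (allFin n)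

    Central Pendant : Edge (n + n) (n + n) → Set
    Central e = Low (proj₁ e) × Low (proj₂ e)
    Pendant e = proj₂ e ≡ opposite (proj₁ e)

    central? : ∀ e → Dec (Central e)
    central? e = low? (proj₁ e) ×-dec low? (proj₂ e)

    pendant? : ∀ e → Dec (Pendant e)
    pendant? e = proj₂ e Fin.≟ opposite (proj₁ e)

    pendants thickZ : List (Edge (n + n) (n + n))
    pendants = map (λ v → v , opposite v) (allFin (n + n))
    thickZ = cartesianProduct lows lows ++ pendants

    length-allFin : ∀ k → length (allFin k) ≡ k
    length-allFin k = Listₚ.length-tabulate {n = k} _

    length-lows : length lows ≡ n
    length-lows = trans (Listₚ.length-map _ (allFin n)) (length-allFin n)

    length-pendants : length pendants ≡ n + n
    length-pendants = trans (Listₚ.length-map _ (allFin (n + n))) (length-allFin (n + n))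

    lows-unique : Unique lows
    lows-unique = Uniqueₚ.map⁺ (Finₚ.↑ˡ-injective n _ _) (Uniqueₚ.allFin⁺ n)

    ∈lows : ∀ {v} → Low v → v ∈ lows
    ∈lows {v} v<n = subst (_∈ lows)
      (Finₚ.toℕ-injective (trans (Finₚ.toℕ-↑ˡ (fromℕ< v<n) n) (Finₚ.toℕ-fromℕ< v<n)))
      (∈-map⁺ (_↑ˡ n) (∈-allFin (fromℕ< v<n)))

    ∈lows⁻ : ∀ {v} → v ∈ lows → Low v
    ∈lows⁻ v∈ with ∈-map⁻ (_↑ˡ n) v∈
    ... | i , _ , refl = subst (_< n) (sym (Finₚ.toℕ-↑ˡ i n)) (Finₚ.toℕ<n i)

    ¬low⇒opposite-low : ∀ v → ¬ Low v → Low (opposite v)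
    ¬low⇒opposite-low v v≮n = begin
      suc (toℕ (opposite v))   ≡⟨ cong suc (Finₚ.opposite-prop v) ⟩
      suc (n + n ∸ suc (toℕ v)) ≡⟨ sym (+-∸-assoc 1 (Finₚ.toℕ<n v)) ⟩
      n + n ∸ toℕ v             ≤⟨ ∸-monoʳ-≤ (n + n) (≮⇒≥ v≮n) ⟩
      n + n ∸ n                 ≡⟨ m+n∸n≡m n n ⟩
      n                         ∎
      where open ≤-Reasoning

    low⇒opposite-¬low : ∀ v → Low v → ¬ Low (opposite v)
    low⇒opposite-¬low v v<n = ≤⇒≯ (begin
      n                     ≡⟨ sym (m+n∸n≡m n n) ⟩
      n + n ∸ n             ≤⟨ ∸-monoʳ-≤ (n + n) v<n ⟩
      n + n ∸ suc (toℕ v)   ≡⟨ sym (Finₚ.opposite-prop v) ⟩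
      toℕ (opposite v)      ∎)
      where open ≤-Reasoning

    ∈pendants : ∀ {e} → Pendant e → e ∈ pendants
    ∈pendants {v , _} refl = ∈-map⁺ _ (∈-allFin v)

    ∈pendants⁻ : ∀ {e} → e ∈ pendants → Pendant e
    ∈pendants⁻ e∈ with ∈-map⁻ (λ v → v , opposite v) e∈
    ... | _ , _ , refl = refl

    pendants-unique : Unique pendants
    pendants-unique = Uniqueₚ.map⁺ (cong proj₁) (Uniqueₚ.allFin⁺ (n + n))

    thickZ-unique : Unique thickZ
    thickZ-unique = Uniqueₚ.++⁺ (Uniqueₚ.cartesianProduct⁺ lows-unique lows-unique) pendants-unique
      λ { {v , w} (e∈ , e∈′) → let v∈ , w∈ = ∈-cartesianProduct⁻ lows lows e∈ in
          low⇒opposite-¬low v (∈lows⁻ v∈) (subst Low (∈pendants⁻ e∈′) (∈lows⁻ w∈)) }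

    length-thickZ : length thickZ ≡ n * n + (n + n)
    length-thickZ = begin
      length thickZ
        ≡⟨ Listₚ.length-++ (cartesianProduct lows lows) ⟩
      length (cartesianProduct lows lows) + length pendants
        ≡⟨ cong₂ _+_ (sym (∑-length (cartesianProduct lows lows))) length-pendants ⟩
      ∑[ e ∈ cartesianProduct lows lows ] 1 + (n + n)
        ≡⟨ cong (_+ (n + n)) (∑-cartesianProduct _ lows lows) ⟩
      ∑[ v ∈ lows ] ∑[ w ∈ lows ] 1 + (n + n)
        ≡⟨ cong (_+ (n + n)) (∑-const _ lows) ⟩
      length lows * ∑[ w ∈ lows ] 1 + (n + n)
        ≡⟨ cong (_+ (n + n)) (cong₂ _*_ length-lows (trans (∑-length lows) length-lows)) ⟩
      n * n + (n + n) ∎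
      where open ≡-Reasoning

    -- Counting covered central vertices: the limit on every algorithm.

    coverage : Edge (n + n) (n + n) → ℕ
    coverage e = ⟦ low? (proj₁ e) ⟧ + ⟦ low? (proj₂ e) ⟧

    #pendants : List (Edge (n + n) (n + n)) → ℕ
    #pendants σ = ∑[ e ∈ σ ] ⟦ pendant? e ⟧

    ⟦yes⟧ : ∀ {P : Set} (P? : Dec P) → P → ⟦ P? ⟧ ≡ 1
    ⟦yes⟧ (yes _) p = refl
    ⟦yes⟧ (no ¬p) p = contradiction p ¬p

    coverage-pos : ∀ {e} → e ∈ thickZ → 1 ≤ coverage e
    coverage-pos {v , w} e∈ with ∈-++⁻ (cartesianProduct lows lows) e∈
    ... | inj₁ c∈ rewrite ⟦yes⟧ (low? v) (∈lows⁻ (proj₁ (∈-cartesianProduct⁻ lows lows c∈))) = s≤s z≤n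
    ... | inj₂ p∈ with ∈pendants⁻ p∈ | low? v
    ... | _    | yes _  = s≤s z≤n
    ... | refl | no ¬lo = ≤-reflexive (sym (⟦yes⟧ (low? w) (¬low⇒opposite-low v ¬lo)))

    coverage+pendant : ∀ {e} → e ∈ thickZ → 2 ≤ coverage e + ⟦ pendant? e ⟧
    coverage+pendant {e@(v , w)} e∈ with ∈-++⁻ (cartesianProduct lows lows) e∈
    ... | inj₁ c∈ with ∈-cartesianProduct⁻ lows lows c∈
    ...   | v∈ , w∈ rewrite ⟦yes⟧ (low? v) (∈lows⁻ v∈) | ⟦yes⟧ (low? w) (∈lows⁻ w∈) = s≤s (s≤s z≤n)
    coverage+pendant {e@(v , w)} e∈ | inj₂ p∈ rewrite ⟦yes⟧ (pendant? (v , w)) (∈pendants⁻ p∈) =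
      +-monoˡ-≤ 1 (coverage-pos e∈)

    -- A matching meets each of the `n` central vertices on either side at most once.
    matching-coverage : ∀ {M} → IsMatching M → ∑ M coverage ≤ n + n
    matching-coverage {M} (u , v) = begin
      ∑ M coverage
        ≡⟨ ∑-+ _ _ M ⟩
      ∑[ e ∈ M ] ⟦ low? (proj₁ e) ⟧ + ∑[ e ∈ M ] ⟦ low? (proj₂ e) ⟧
        ≡⟨ sym (cong₂ _+_ (∑-map proj₁ _ M) (∑-map proj₂ _ M)) ⟩
      ∑[ x ∈ map proj₁ M ] ⟦ low? x ⟧ + ∑[ x ∈ map proj₂ M ] ⟦ low? x ⟧
        ≤⟨ +-mono-≤ (at-most-n u) (at-most-n v) ⟩
      n + n ∎
      where
      open ≤-Reasoning
      at-most-n : ∀ {xs} → Unique xs → ∑[ x ∈ xs ] ⟦ low? x ⟧ ≤ n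
      at-most-n {xs} u = begin
        ∑[ x ∈ xs ] ⟦ low? x ⟧    ≡⟨ ∑-⟦⟧ low? xs ⟩
        length (filter low? xs)   ≤⟨ Unique⇒length≤ (Uniqueₚ.filter⁺ low? u) (λ x∈ → ∈lows (proj₂ (∈-filter⁻ low? {xs = xs} x∈))) ⟩
        length lows               ≡⟨ length-lows ⟩
        n                         ∎

    module _ (accept : List (Edge (n + n) (n + n)) → Edge (n + n) (n + n) → Bool) where

      -- An edge accepted within the prefix `drop d σ` counts twice on the left, a later one once.
      -- The later edge is paid for by its coverage; the edge of the prefix is paid for by its
      -- coverage plus 1 if it is pendant. Rejected pendant edges of the prefix only enlarge the
      -- right side.
      output-coverage : ∀ d {σ} → All (_∈ thickZ) σ →
        length (output accept σ) + length (output accept (drop d σ)) ≤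
        ∑ (output accept σ) coverage + #pendants (drop d σ)
      output-coverage zero [] = z≤n
      output-coverage zero {e ∷ past} (e∈ ∷ past∈) with accept past e
      ... | true  = begin
        suc a + suc a           ≡⟨ cong suc (+-suc a a) ⟩
        2 + (a + a)             ≤⟨ +-mono-≤ (coverage+pendant e∈) (output-coverage zero past∈) ⟩
        w + p + (W + X)         ≡⟨ interchange w p W X ⟩
        w + W + (p + X)         ∎
        where
        open ≤-Reasoning
        a = length (output accept past)
        w = coverage e
        p = ⟦ pendant? e ⟧
        W = ∑ (output accept past) coverage
        X = #pendants past
        interchange : ∀ w p W X → w + p + (W + X) ≡ w + W + (p + X)
        interchange = solve-∀
      ... | false = ≤-trans (output-coverage zero past∈)
        (+-monoʳ-≤ (∑ (output accept past) coverage) (m≤n+m (#pendants past) ⟦ pendant? e ⟧))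
      output-coverage (suc d) [] = z≤n
      output-coverage (suc d) {e ∷ past} (e∈ ∷ past∈) with accept past e
      ... | true  = ≤-trans (+-mono-≤ (coverage-pos e∈) (output-coverage d past∈))
                            (≤-reflexive (sym (+-assoc (coverage e) (∑ (output accept past) coverage) (#pendants (drop d past)))))
      ... | false = output-coverage d past∈

    -- The pendant edges form a perfect matching because `opposite` is an involution.
    optimum-full : ∀ {σ} → Unique σ → thickZ ⊆ σ → n + n ≤ optimum σ
    optimum-full {σ} u sub = begin
      n + n                       ≡⟨ sym length-pendants ⟩
      length pendants             ≤⟨ Unique⇒length≤ pendants-unique (λ e∈ →
                                       ∈-filter⁺ pendant? (sub (∈-++⁺ʳ (cartesianProduct lows lows) e∈)) (∈pendants⁻ e∈)) ⟩
      length (filter pendant? σ)  ≤⟨ length≤optimum σ (filter∈sublists pendant? σ) matching ⟩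
      optimum σ                   ∎
      where
      open ≤-Reasoning
      pendant : ∀ {e} → e ∈ filter pendant? σ → Pendant e
      pendant e∈ = proj₂ (∈-filter⁻ pendant? {xs = σ} e∈)
      opposite-injective : ∀ {v w : V} → opposite v ≡ opposite w → v ≡ w
      opposite-injective {v} {w} eq =
        trans (sym (Finₚ.opposite-involutive v)) (trans (cong opposite eq) (Finₚ.opposite-involutive w))
      same-left : ∀ {e e′} → Pendant e → Pendant e′ → proj₁ e ≡ proj₁ e′ → e ≡ e′
      same-left refl refl refl = refl
      matching : IsMatching (filter pendant? σ)
      matching =
        unique-map proj₁ (λ x∈ y∈ → same-left (pendant x∈) (pendant y∈)) (Uniqueₚ.filter⁺ pendant? u) ,
        unique-map proj₂ (λ x∈ y∈ eq → same-left (pendant x∈) (pendant y∈)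
          (opposite-injective (trans (sym (pendant x∈)) (trans eq (pendant y∈))))) (Uniqueₚ.filter⁺ pendant? u)

    -- Greedy matchings and pendant edges in a prefix of the random order.

    open Arrangements (≡-dec Fin._≟_ Fin._≟_) thickZ public
    open Greedy central? public

    unmatched : List (Edge (n + n) (n + n)) → ℕ
    unmatched σ = n ∸ length (greedy σ)

    length-greedy≤n : ∀ σ → length (greedy σ) ≤ n
    length-greedy≤n σ = begin
      length (greedy σ)              ≡⟨ sym (Listₚ.length-map proj₁ (greedy σ)) ⟩
      length (map proj₁ (greedy σ))  ≤⟨ Unique⇒length≤ (proj₁ (greedy-matching σ)) lefts⊆ ⟩
      length lows                    ≡⟨ length-lows ⟩
      n                              ∎
      where
      open ≤-Reasoning
      lefts⊆ : map proj₁ (greedy σ) ⊆ lows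
      lefts⊆ v∈ with ∈-map⁻ proj₁ v∈
      ... | e , e∈ , refl = ∈lows (proj₁ (All.lookup (greedy-F σ) e∈))

    -- On each side at least `unmatched past` central vertices are free. Any central edge joining
    -- two free vertices would be accepted, and by maximality none of these edges has arrived yet,
    -- so all of them are available.
    greedy-gain : ∀ past →
      unmatched past * unmatched past ≤ ∑[ e ∈ avail past ] ⟦ accepts? past e ⟧
    greedy-gain past = begin
      unmatched past * unmatched past
        ≤⟨ *-mono-≤ (free-lows (map proj₁ M) (Listₚ.length-map proj₁ M)) (free-lows (map proj₂ M) (Listₚ.length-map proj₂ M)) ⟩
      ∑[ v ∈ lows ] ⟦ ∉lefts? v ⟧ * ∑[ w ∈ lows ] ⟦ ∉rights? w ⟧
        ≡⟨ sym (∑-*ʳ _ _ lows) ⟩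
      ∑[ v ∈ lows ] (⟦ ∉lefts? v ⟧ * ∑[ w ∈ lows ] ⟦ ∉rights? w ⟧)
        ≡⟨ (∑-cong lows λ v _ → sym (∑-*ˡ ⟦ ∉lefts? v ⟧ _ lows)) ⟩
      ∑[ v ∈ lows ] ∑[ w ∈ lows ] (⟦ ∉lefts? v ⟧ * ⟦ ∉rights? w ⟧)
        ≤⟨ (∑-mono lows λ v v∈ → ∑-mono lows λ w w∈ →
             product≤ (∉lefts? v) (∉rights? w) (accepts? past (v , w))
               λ v∉ w∉ → (∈lows⁻ v∈ , ∈lows⁻ w∈) , (v∉ , w∉)) ⟩
      ∑[ v ∈ lows ] ∑[ w ∈ lows ] ⟦ accepts? past (v , w) ⟧
        ≡⟨ sym (∑-cartesianProduct _ lows lows) ⟩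
      ∑[ e ∈ cartesianProduct lows lows ] ⟦ accepts? past e ⟧
        ≤⟨ m≤m+n _ _ ⟩
      ∑[ e ∈ cartesianProduct lows lows ] ⟦ accepts? past e ⟧ + ∑[ e ∈ pendants ] ⟦ accepts? past e ⟧
        ≡⟨ sym (∑-++ _ (cartesianProduct lows lows) pendants) ⟩
      ∑[ e ∈ thickZ ] ⟦ accepts? past e ⟧
        ≤⟨ (∑-mono thickZ λ e _ → guard≤ (¬? (e ∈? past)) (accepts? past e)
             λ (central , free) → greedy-maximal past central free) ⟩
      ∑[ e ∈ thickZ ] (if does (¬? (e ∈? past)) then ⟦ accepts? past e ⟧ else 0)
        ≡⟨ sym (∑-filter _ _ thickZ) ⟩
      ∑[ e ∈ avail past ] ⟦ accepts? past e ⟧ ∎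
      where
      open ≤-Reasoning
      module ∈ᵥ = DecMembership (Fin._≟_ {n + n})
      open DecMembership (≡-dec (Fin._≟_ {n + n}) (Fin._≟_ {n + n})) using (_∈?_)
      M = greedy past
      ∉lefts? : ∀ v → Dec (v ∉ map proj₁ M)
      ∉lefts? v = ¬? (v ∈ᵥ.∈? map proj₁ M)
      ∉rights? : ∀ w → Dec (w ∉ map proj₂ M)
      ∉rights? w = ¬? (w ∈ᵥ.∈? map proj₂ M)
      free-lows : ∀ vs → length vs ≡ length M → unmatched past ≤ ∑[ v ∈ lows ] ⟦ ¬? (v ∈ᵥ.∈? vs) ⟧
      free-lows vs eq = begin
        n ∸ length M                                     ≡⟨ cong (n ∸_) (sym eq) ⟩
        n ∸ length vs                                    ≤⟨ m≤n+o⇒m∸n≤o n (length vs)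
            (≤-trans (≤-reflexive (sym length-lows)) (length-removal-≥ ∈ᵥ._∈?_ vs lows-unique)) ⟩
        length (filter (λ v → ¬? (v ∈ᵥ.∈? vs)) lows)    ≡⟨ sym (∑-⟦⟧ _ lows) ⟩
        ∑[ v ∈ lows ] ⟦ ¬? (v ∈ᵥ.∈? vs) ⟧               ∎
      product≤ : ∀ {P Q R : Set} (P? : Dec P) (Q? : Dec Q) (R? : Dec R) → (P → Q → R) →
        ⟦ P? ⟧ * ⟦ Q? ⟧ ≤ ⟦ R? ⟧
      product≤ (yes p) (yes q) R? f = ≤-reflexive (sym (⟦yes⟧ R? (f p q)))
      product≤ (yes p) (no ¬q) R? f = z≤n
      product≤ (no ¬p) Q?      R? f = z≤n
      guard≤ : ∀ {P Q : Set} (P? : Dec P) (Q? : Dec Q) → (Q → P) →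
        ⟦ Q? ⟧ ≤ (if does P? then ⟦ Q? ⟧ else 0)
      guard≤ (yes p) Q?      f = ≤-refl
      guard≤ (no ¬p) (yes q) f = contradiction (f q) ¬p
      guard≤ (no ¬p) (no ¬q) f = z≤n

    -- Given its past, each arriving edge enlarges the greedy matching with
    -- probability at least unmatched² / m.
    ∑unmatched² : ∀ s →
      s * ∑[ σ ∈ Seq s ] (unmatched σ * unmatched σ) ≤ m * ∑[ σ ∈ Seq s ] length (greedy σ)
    ∑unmatched² zero    = z≤n
    ∑unmatched² (suc s) = begin
      suc s * ∑[ σ ∈ Seq (suc s) ] u² σ
        ≡⟨ cong (suc s *_) (∑-Seq-suc s u²) ⟩
      suc s * ∑[ past ∈ Seq s ] ∑[ e ∈ avail past ] u² (e ∷ past)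
        ≤⟨ *-monoʳ-≤ (suc s) (∑-mono (Seq s) λ past _ → ∑-mono (avail past) λ e _ →
             *-mono-≤ (unmatched-antitone past e) (unmatched-antitone past e)) ⟩
      suc s * ∑[ past ∈ Seq s ] ∑[ e ∈ avail past ] u² past
        ≡⟨ cong (suc s *_) (∑-Seq-tail thickZ-unique s u²) ⟩
      suc s * ((m ∸ s) * U)
        ≡⟨ expand s (m ∸ s) U ⟩
      (m ∸ s) * (s * U) + (m ∸ s) * U
        -- Of the `suc s` copies of `U`, the induction hypothesis charges `s` to the edges matched
        -- so far, and the remaining one is charged to the expected gain from the next arrival. That
        -- `unmatched` never increases allowed all copies to refer to time `s`.
        ≤⟨ +-mono-≤ (*-monoʳ-≤ (m ∸ s) (∑unmatched² s))
             (*-mono-≤ (m∸n≤m m s) (∑-mono (Seq s) λ past _ → greedy-gain past)) ⟩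
      (m ∸ s) * (m * G) + m * gain
        ≡⟨ collect (m ∸ s) m G gain ⟩
      m * ((m ∸ s) * G + gain)
        ≡⟨ cong (λ k → m * (k + gain)) (sym (∑-Seq-tail thickZ-unique s (length ∘ greedy))) ⟩
      m * (∑[ past ∈ Seq s ] ∑[ e ∈ avail past ] length (greedy past) + gain)
        ≡⟨ cong (m *_) (sym (∑-+ _ _ (Seq s))) ⟩
      m * ∑[ past ∈ Seq s ] (∑[ e ∈ avail past ] length (greedy past) + ∑[ e ∈ avail past ] ⟦ accepts? past e ⟧)
        ≡⟨ cong (m *_) (∑-cong (Seq s) λ past _ →
             trans (sym (∑-+ _ _ (avail past)))
                   (∑-cong (avail past) λ e _ → sym (length-greedy-∷ past e))) ⟩
      m * ∑[ past ∈ Seq s ] ∑[ e ∈ avail past ] length (greedy (e ∷ past))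
        ≡⟨ cong (m *_) (sym (∑-Seq-suc s (length ∘ greedy))) ⟩
      m * ∑[ σ ∈ Seq (suc s) ] length (greedy σ) ∎
      where
      open ≤-Reasoning
      u² : List (Edge (n + n) (n + n)) → ℕ
      u² σ = unmatched σ * unmatched σ
      U = ∑ (Seq s) u²
      G = ∑[ σ ∈ Seq s ] length (greedy σ)
      gain = ∑[ past ∈ Seq s ] ∑[ e ∈ avail past ] ⟦ accepts? past e ⟧
      unmatched-antitone : ∀ past e → unmatched (e ∷ past) ≤ unmatched past
      unmatched-antitone past e = ∸-monoʳ-≤ n
        (≤-trans (m≤m+n (length (greedy past)) _) (≤-reflexive (sym (length-greedy-∷ past e))))
      expand : ∀ s k U → suc s * (k * U) ≡ k * (s * U) + k * U
      expand = solve-∀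
      collect : ∀ k m G g → k * (m * G) + m * g ≡ m * (k * G + g)
      collect = solve-∀

    -- At each of the first `t` arrivals at least `m ∸ t` edges remain to choose from, and at most
    -- `n + n` of them are pendant. Keeping `t` fixed gives the induction on `s` a constant factor.
    ∑#pendants : ∀ t s → s ≤ t →
      (m ∸ t) * ∑ (Seq s) #pendants ≤ s * ((n + n) * length (Seq s))
    ∑#pendants t zero    _   = ≤-reflexive (*-zeroʳ (m ∸ t))
    ∑#pendants t (suc s) s<t = begin
      (m ∸ t) * ∑ (Seq (suc s)) #pendants
        ≡⟨ cong ((m ∸ t) *_) (∑-Seq-suc s #pendants) ⟩
      (m ∸ t) * ∑[ past ∈ Seq s ] ∑[ e ∈ avail past ] (⟦ pendant? e ⟧ + #pendants past)
        ≡⟨ cong ((m ∸ t) *_) (trans (∑-cong (Seq s) λ past _ → ∑-+ _ _ (avail past)) (∑-+ _ _ (Seq s))) ⟩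
      (m ∸ t) * (∑[ past ∈ Seq s ] #pendants (avail past) + ∑[ past ∈ Seq s ] ∑[ e ∈ avail past ] #pendants past)
        ≡⟨ cong (λ k → (m ∸ t) * (∑[ past ∈ Seq s ] #pendants (avail past) + k)) (∑-Seq-tail thickZ-unique s #pendants) ⟩
      (m ∸ t) * (∑[ past ∈ Seq s ] #pendants (avail past) + (m ∸ s) * X)
        ≤⟨ *-monoʳ-≤ (m ∸ t) (+-monoˡ-≤ ((m ∸ s) * X) (≤-trans (∑-mono (Seq s) λ past _ → new-pendants past)
             (≤-reflexive (trans (∑-const (n + n) (Seq s)) (*-comm N (n + n)))))) ⟩
      (m ∸ t) * ((n + n) * N + (m ∸ s) * X)
        ≡⟨ rearrange (m ∸ t) ((n + n) * N) (m ∸ s) X ⟩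
      (m ∸ t) * ((n + n) * N) + (m ∸ s) * ((m ∸ t) * X)
        ≤⟨ +-mono-≤ (*-monoˡ-≤ ((n + n) * N) (∸-monoʳ-≤ m (≤-trans (n≤1+n s) s<t)))
                    (*-monoʳ-≤ (m ∸ s) (∑#pendants t s (≤-trans (n≤1+n s) s<t))) ⟩
      (m ∸ s) * ((n + n) * N) + (m ∸ s) * (s * ((n + n) * N))
        ≡⟨ collect (m ∸ s) (n + n) N s ⟩
      suc s * ((n + n) * ((m ∸ s) * N))
        ≡⟨ cong (λ k → suc s * ((n + n) * k)) (sym (length-Seq-suc thickZ-unique s)) ⟩
      suc s * ((n + n) * length (Seq (suc s))) ∎
      where
      open ≤-Reasoning
      N = length (Seq s)
      X = ∑ (Seq s) #pendants
      new-pendants : ∀ past → #pendants (avail past) ≤ n + n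
      new-pendants past = begin
        #pendants (avail past)               ≡⟨ ∑-⟦⟧ pendant? (avail past) ⟩
        length (filter pendant? (avail past)) ≤⟨ Unique⇒length≤
            (Uniqueₚ.filter⁺ pendant? (Uniqueₚ.filter⁺ _ thickZ-unique))
            (λ e∈ → ∈pendants (proj₂ (∈-filter⁻ pendant? {xs = avail past} e∈))) ⟩
        length pendants                      ≡⟨ length-pendants ⟩
        n + n                                ∎
      rearrange : ∀ k a l X → k * (a + l * X) ≡ k * a + l * (k * X)
      rearrange = solve-∀
      collect : ∀ k n N s → k * (n * N) + k * (s * (n * N)) ≡ suc s * (n * (k * N))
      collect = solve-∀

  -- The tradeoff between the prefix and the whole graph for a deterministic algorithm.

  module Tradeoff (n a k t : ℕ) (n≡ : n ≡ suc k * a) (0<a : 0 < a) (0<t : 0 < t)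
    (few-pendants : suc k * t + t ≤ length (ThickZ.thickZ n))
    (long-prefix : length (ThickZ.thickZ n) * n ≤ t * (a * a)) where

    open ThickZ n
    open DecMembership (≡-dec (Fin._≟_ {n + n}) (Fin._≟_ {n + n})) using (_∈?_)

    K d : ℕ
    K = suc k
    d = m ∸ t

    private
      instance
        t≢0 : NonZero t
        t≢0 = >-nonZero 0<t
        a≢0 : NonZero a
        a≢0 = >-nonZero 0<a

    d+t≡m : d + t ≡ m
    d+t≡m = m∸n+n≡m (≤-trans (m≤n+m t (K * t)) few-pendants)

    -- `N` counts the prefixes, `W` the full orders, and `w` the full orders that continue a given
    -- prefix.
    N W w : ℕ
    N = length (Seq t)
    W = length (Seq (d + t))
    w = extensions thickZ-unique d t

    W≡ : W ≡ w * N
    W≡ = begin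
      W                         ≡⟨ sym (∑-length (Seq (d + t))) ⟩
      ∑[ σ ∈ Seq (d + t) ] 1    ≡⟨ ∑-Seq-drop thickZ-unique d t (λ _ → 1) ⟩
      w * ∑[ σ ∈ Seq t ] 1      ≡⟨ cong (w *_) (∑-length (Seq t)) ⟩
      w * N                     ∎
      where open ≡-Reasoning

    -- At least `K * t` edges come after the prefix, so `∑#pendants` bounds the mean number of
    -- pendant edges in the prefix by `(n + n) / K`.
    prefix-pendants : K * ∑ (Seq t) #pendants ≤ (n + n) * N
    prefix-pendants = *-cancelˡ-≤ t (begin
      t * (K * X)               ≡⟨ rearrange t K X ⟩
      K * t * X                 ≤⟨ *-monoˡ-≤ X (m+n≤o⇒m≤o∸n (K * t) few-pendants) ⟩
      (m ∸ t) * X               ≤⟨ ∑#pendants t t ≤-refl ⟩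
      t * ((n + n) * N)         ∎)
      where
      open ≤-Reasoning
      X = ∑ (Seq t) #pendants
      rearrange : ∀ t K X → t * (K * X) ≡ K * t * X
      rearrange = solve-∀

    -- By `∑unmatched²` and the length of the prefix, the mean of the squares is at most `a * a`.
    -- The inequality between arithmetic and geometric means passes from the squares to the first
    -- moment, in place of Cauchy-Schwarz.
    ∑-unmatched : ∑ (Seq t) unmatched ≤ a * N
    ∑-unmatched = *-cancelˡ-≤ (2 * a) {{m*n≢0 2 a}} (begin
      2 * a * ∑ (Seq t) unmatched
        ≡⟨ sym (∑-*ˡ (2 * a) unmatched (Seq t)) ⟩
      ∑[ σ ∈ Seq t ] (2 * a * unmatched σ)
        ≤⟨ ∑-mono (Seq t) (λ σ _ → am-gm a (unmatched σ)) ⟩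
      ∑[ σ ∈ Seq t ] (unmatched σ * unmatched σ + a * a)
        ≡⟨ trans (∑-+ _ _ (Seq t)) (cong (U +_) (∑-const (a * a) (Seq t))) ⟩
      U + N * (a * a)
        ≤⟨ +-monoˡ-≤ (N * (a * a)) U≤ ⟩
      N * (a * a) + N * (a * a)
        ≡⟨ rearrange N a ⟩
      2 * a * (a * N) ∎)
      where
      open ≤-Reasoning
      U = ∑[ σ ∈ Seq t ] (unmatched σ * unmatched σ)
      rearrange : ∀ N a → N * (a * a) + N * (a * a) ≡ 2 * a * (a * N)
      rearrange = solve-∀
      expand : ∀ x z → 2 * x * (x + z) + z * z ≡ (x + z) * (x + z) + x * x
      expand = solve-∀
      expand′ : ∀ x z → 2 * (x + z) * x + z * z ≡ x * x + (x + z) * (x + z)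
      expand′ = solve-∀
      am-gm : ∀ x y → 2 * x * y ≤ y * y + x * x
      am-gm x y with ≤-total x y
      ... | inj₁ x≤y with m≤n⇒∃[o]m+o≡n x≤y
      ...   | z , refl = m+n≤o⇒m≤o (2 * x * (x + z)) (≤-reflexive (expand x z))
      am-gm x y | inj₂ y≤x with m≤n⇒∃[o]m+o≡n y≤x
      ...   | z , refl = m+n≤o⇒m≤o (2 * (y + z) * y) (≤-reflexive (expand′ y z))
      U≤ : U ≤ N * (a * a)
      U≤ = *-cancelˡ-≤ t (begin
        t * U                                    ≤⟨ ∑unmatched² t ⟩
        m * ∑[ σ ∈ Seq t ] length (greedy σ)     ≤⟨ *-monoʳ-≤ m (∑-mono (Seq t) λ σ _ → length-greedy≤n σ) ⟩
        m * ∑[ σ ∈ Seq t ] n                     ≡⟨ cong (m *_) (∑-const n (Seq t)) ⟩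
        m * (N * n)                              ≡⟨ swap-factors m N n ⟩
        m * n * N                                ≤⟨ *-monoˡ-≤ N long-prefix ⟩
        t * (a * a) * N                          ≡⟨ swap-factors′ t (a * a) N ⟩
        t * (N * (a * a))                        ∎)
        where
        swap-factors : ∀ x y z → x * (y * z) ≡ x * z * y
        swap-factors = solve-∀
        swap-factors′ : ∀ x y z → x * y * z ≡ x * (z * y)
        swap-factors′ = solve-∀

    -- The greedy matching is a matching within the prefix, of size `n` less the unmatched part.
    prefix-optimum : n * N ≤ ∑ (Seq t) optimum + a * N
    prefix-optimum = begin
      n * N                                            ≡⟨ *-comm n N ⟩
      N * n                                            ≡⟨ sym (∑-const n (Seq t)) ⟩
      ∑[ σ ∈ Seq t ] n                                 ≤⟨ ∑-mono (Seq t) (λ σ _ → n≤ σ) ⟩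
      ∑[ σ ∈ Seq t ] (optimum σ + unmatched σ)         ≡⟨ ∑-+ optimum unmatched (Seq t) ⟩
      ∑ (Seq t) optimum + ∑ (Seq t) unmatched          ≤⟨ +-monoʳ-≤ (∑ (Seq t) optimum) ∑-unmatched ⟩
      ∑ (Seq t) optimum + a * N                        ∎
      where
      open ≤-Reasoning
      n≤ : ∀ σ → n ≤ optimum σ + unmatched σ
      n≤ σ = begin
        n                                  ≡⟨ sym (m+[n∸m]≡n (length-greedy≤n σ)) ⟩
        length (greedy σ) + unmatched σ    ≤⟨ +-monoˡ-≤ (unmatched σ)
                                                (length≤optimum σ (greedy∈sublists σ) (greedy-matching σ)) ⟩
        optimum σ + unmatched σ            ∎

    full-optimum : (n + n) * W ≤ ∑ (Seq (d + t)) optimum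
    full-optimum = begin
      (n + n) * W                    ≡⟨ *-comm (n + n) W ⟩
      W * (n + n)                    ≡⟨ sym (∑-const (n + n) (Seq (d + t))) ⟩
      ∑[ σ ∈ Seq (d + t) ] (n + n)   ≤⟨ ∑-mono (Seq (d + t)) (λ σ σ∈ →
          optimum-full (unique (Seq⇒IsArrangement (d + t) σ∈)) (complete σ σ∈)) ⟩
      ∑ (Seq (d + t)) optimum        ∎
      where
      open ≤-Reasoning
      complete : ∀ σ → σ ∈ Seq (d + t) → thickZ ⊆ σ
      complete σ σ∈ {e} e∈ with e ∈? σ
      ... | yes e∈σ = e∈σ
      -- A missing edge would still be available, but after `d + t`, that is all `m`, arrivals
      -- nothing is.
      ... | no e∉σ with avail σ | ∈-filter⁺ (λ e → ¬? (e ∈? σ)) e∈ e∉σ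
                      | length-avail thickZ-unique (d + t) σ∈
      ...   | x ∷ xs | _ | eq = contradiction (trans eq (sym d+t≡m)) (m+1+n≢m (d + t))

    -- Each prefix is listed once per full order continuing it, so that prefixes and full orders
    -- have equal total weight `W`.
    prefixes : List (List (Edge (n + n) (n + n)))
    prefixes = map (drop d) (Seq (d + t))

    ∑-prefixes : ∀ φ → ∑ prefixes φ ≡ w * ∑ (Seq t) φ
    ∑-prefixes φ = trans (∑-map (drop d) φ (Seq (d + t))) (∑-Seq-drop thickZ-unique d t φ)

    -- On average a prefix has optimum at least `n - a` and the whole graph `2n`. With `n = K * a`
    -- these add up to `(3K - 1) a`, and `3K - 1` is `3 * k + 2`. Adding `a * W` to both sides
    -- avoids the subtraction.
    total-optimum : (3 * k + 2) * a * W ≤ ∑ prefixes optimum + ∑ (Seq (d + t)) optimum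
    total-optimum = +-cancelʳ-≤ (a * W) _ _ (begin
      (3 * k + 2) * a * W + a * W
        ≡⟨ rearrange k a W ⟩
      K * a * W + (K * a + K * a) * W
        ≡⟨ cong (λ j → j * W + (j + j) * W) (sym n≡) ⟩
      n * W + (n + n) * W
        ≤⟨ +-mono-≤ prefix-part full-optimum ⟩
      (∑ prefixes optimum + a * W) + ∑ (Seq (d + t)) optimum
        ≡⟨ swap-last (∑ prefixes optimum) (a * W) _ ⟩
      ∑ prefixes optimum + ∑ (Seq (d + t)) optimum + a * W ∎)
      where
      open ≤-Reasoning
      rearrange : ∀ k a W → (3 * k + 2) * a * W + a * W ≡ suc k * a * W + (suc k * a + suc k * a) * W
      rearrange = solve-∀
      swap-last : ∀ x y z → x + y + z ≡ x + z + y
      swap-last = solve-∀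
      factor : ∀ w O a N → w * (O + a * N) ≡ w * O + a * (w * N)
      factor = solve-∀
      swap-factors : ∀ n w N → n * (w * N) ≡ w * (n * N)
      swap-factors = solve-∀
      prefix-part : n * W ≤ ∑ prefixes optimum + a * W
      prefix-part = begin
        n * W                             ≡⟨ trans (cong (n *_) W≡) (swap-factors n w N) ⟩
        w * (n * N)                       ≤⟨ *-monoʳ-≤ w prefix-optimum ⟩
        w * (∑ (Seq t) optimum + a * N)   ≡⟨ factor w _ a N ⟩
        w * ∑ (Seq t) optimum + a * (w * N) ≡⟨ cong₂ _+_ (sym (∑-prefixes optimum)) (cong (a *_) (sym W≡)) ⟩
        ∑ prefixes optimum + a * W        ∎

    module _ (D : DeterministicAlgorithm (n + n) (n + n)) where

      -- For each full order, prefix output and final output together are at most `2n` plus the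
      -- number of pendant edges in the prefix, which averages to at most `2n / K`.
      total-output : K * (∑ prefixes (outputSize D) + ∑ (Seq (d + t)) (outputSize D)) ≤ 2 * K * (K + 1) * a * W
      total-output = begin
        K * (∑ prefixes (outputSize D) + ∑ (Seq (d + t)) (outputSize D))
          ≡⟨ cong (K *_) (trans (cong (_+ ∑ (Seq (d + t)) (outputSize D)) (∑-map (drop d) (outputSize D) (Seq (d + t)))) (sym (∑-+ _ _ (Seq (d + t))))) ⟩
        K * ∑[ σ ∈ Seq (d + t) ] (outputSize D (drop d σ) + outputSize D σ)
          ≤⟨ *-monoʳ-≤ K (∑-mono (Seq (d + t)) pointwise) ⟩
        K * ∑[ σ ∈ Seq (d + t) ] ((n + n) + #pendants (drop d σ))
          ≡⟨ cong (K *_) (trans (∑-+ _ _ (Seq (d + t))) (cong₂ _+_ (∑-const (n + n) (Seq (d + t))) (∑-Seq-drop thickZ-unique d t #pendants))) ⟩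
        K * (W * (n + n) + w * X)
          ≡⟨ rearrange₁ K W n w X ⟩
        K * (n + n) * W + w * (K * X)
          ≤⟨ +-monoʳ-≤ (K * (n + n) * W) (*-monoʳ-≤ w prefix-pendants) ⟩
        K * (n + n) * W + w * ((n + n) * N)
          ≡⟨ rearrange₂ K W n w N ⟩
        K * (n + n) * W + (n + n) * (w * N)
          ≡⟨ cong₂ (λ i j → K * (i + i) * W + (i + i) * j) n≡ (sym W≡) ⟩
        K * (K * a + K * a) * W + (K * a + K * a) * W
          ≡⟨ rearrange₃ K a W ⟩
        2 * K * (K + 1) * a * W ∎
        where
        open ≤-Reasoning
        X = ∑ (Seq t) #pendants
        rearrange₁ : ∀ K W n w X → K * (W * (n + n) + w * X) ≡ K * (n + n) * W + w * (K * X)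
        rearrange₁ = solve-∀
        rearrange₂ : ∀ K W n w N → K * (n + n) * W + w * ((n + n) * N) ≡ K * (n + n) * W + (n + n) * (w * N)
        rearrange₂ = solve-∀
        rearrange₃ : ∀ K a W → K * (K * a + K * a) * W + (K * a + K * a) * W ≡ 2 * K * (K + 1) * a * W
        rearrange₃ = solve-∀
        pointwise : ∀ σ → σ ∈ Seq (d + t) →
          outputSize D (drop d σ) + outputSize D σ ≤ (n + n) + #pendants (drop d σ)
        pointwise σ σ∈ = begin
          outputSize D (drop d σ) + outputSize D σ
            ≡⟨ +-comm (outputSize D (drop d σ)) _ ⟩
          outputSize D σ + outputSize D (drop d σ)
            ≤⟨ output-coverage (accept D) d (All.tabulate (⊆E arr)) ⟩
          ∑ (output (accept D) σ) coverage + #pendants (drop d σ)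
            ≤⟨ +-monoˡ-≤ (#pendants (drop d σ)) (matching-coverage (valid D (unique arr))) ⟩
          (n + n) + #pendants (drop d σ) ∎
          where
          arr = Seq⇒IsArrangement (d + t) σ∈

      -- The quotient `2 (K + 1) / (3K - 1)` of the two totals is relaxed to `(2K + 6) / (3K)`,
      -- which is 2/3 + 2/K.
      tradeoff : 3 * K * (∑ prefixes (outputSize D) + ∑ (Seq (d + t)) (outputSize D)) ≤
                 (2 * K + 6) * (∑ prefixes optimum + ∑ (Seq (d + t)) optimum)
      tradeoff = begin
        3 * K * S                                 ≡⟨ *-assoc 3 K S ⟩
        3 * (K * S)                               ≤⟨ *-monoʳ-≤ 3 total-output ⟩
        3 * (2 * K * (K + 1) * a * W)             ≤⟨ m+n≤o⇒m≤o _ (≤-reflexive (slack k a W)) ⟩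
        (2 * K + 6) * ((3 * k + 2) * a * W)       ≤⟨ *-monoʳ-≤ (2 * K + 6) total-optimum ⟩
        (2 * K + 6) * (∑ prefixes optimum + ∑ (Seq (d + t)) optimum) ∎
        where
        open ≤-Reasoning
        S = ∑ prefixes (outputSize D) + ∑ (Seq (d + t)) (outputSize D)
        slack : ∀ k a W → 3 * (2 * suc k * (suc k + 1) * a * W) + (10 * k + 4) * a * W ≡
                          (2 * suc k + 6) * ((3 * k + 2) * a * W)
        slack = solve-∀

    prefix∈Seq : ∀ {σ} → σ ∈ prefixes → σ ∈ Seq t
    prefix∈Seq σ∈ with ∈-map⁻ (drop d) σ∈
    ... | τ , τ∈ , refl = Seq-drop thickZ-unique d t τ∈

    optimum-pos : ∀ s {σ} → 0 < s → σ ∈ Seq s → 1 ≤ optimum σ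
    optimum-pos s {[]}    0<s σ∈ = contradiction (size (Seq⇒IsArrangement s σ∈)) (<⇒≢ 0<s)
    optimum-pos s {e ∷ σ} 0<s σ∈ = optimum-nonempty e σ

    total-optimum-pos : 1 ≤ ∑ prefixes optimum + ∑ (Seq (d + t)) optimum
    total-optimum-pos = ≤-trans
      (*-mono-≤ (*-mono-≤ (m≤n+m 1 (3 * k + 1)) 0<a)
        (length-Seq-pos thickZ-unique (d + t) (≤-reflexive d+t≡m)))
      (≤-trans (≤-reflexive (cong (λ j → j * a * W) (+-assoc (3 * k) 1 1))) total-optimum)

  -- Choice of the parameters.

  module ParameterChoice where

    -- Here (K + 1) t ≤ n² leaves K t edges to come after t arrivals, and
    -- (n² + 2n) n ≤ t a² makes a greedy matching miss at most a of the n central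
    -- edges of a perfect matching by then.
    record Parameters (k : ℕ) : Set where
      field
        n a t         : ℕ
        n≡Ka          : n ≡ suc k * a
        0<a           : 0 < a
        0<t           : 0 < t
        few-pendants  : suc k * t + t ≤ n * n + (n + n)
        long-prefix   : (n * n + (n + n)) * n ≤ t * (a * a)

    -- The values solve `(K + 1) t = n²` and `2 n³ = t a²` together with `n = K a`. The pendant
    -- edges raise `n³` to `n³ + 2 n²` in the second condition, which is at most `2 n³` because
    -- `2 ≤ a ≤ n`.
    parameters : ∀ k → Parameters k
    parameters k = record
      { n = n ; a = a ; t = t ; n≡Ka = refl ; 0<a = 0<a ; 0<t = 0<t
      ; few-pendants = ≤-trans (≤-reflexive (square K)) (m≤m+n (n * n) (n + n))
      ; long-prefix  = cubic }
      where
      K a n t : ℕ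
      K = suc k
      a = 2 * K * (K + 1)
      n = K * a
      t = 2 * K * K * K * a
      instance
        2K≢0 : NonZero (2 * K)
        2K≢0 = m*n≢0 2 K
        K+1≢0 : NonZero (K + 1)
        K+1≢0 = >-nonZero (m≤n+m 1 K)
      2≤a : 2 ≤ a
      2≤a = ≤-trans (m≤m*n 2 K) (m≤m*n (2 * K) (K + 1))
      0<a : 0 < a
      0<a = ≤-trans (s≤s z≤n) 2≤a
      0<t : 0 < t
      0<t = *-mono-≤ {1} {2 * K * K * K}
        (>-nonZero⁻¹ (2 * K * K * K) {{m*n≢0 (2 * K * K) K {{m*n≢0 (2 * K) K}}}}) 0<a
      square : ∀ K → let a = 2 * K * (K + 1) ; t = 2 * K * K * K * a in
        K * t + t ≡ K * a * (K * a)
      square = solve-∀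
      cubic : (n * n + (n + n)) * n ≤ t * (a * a)
      cubic = begin
        (n * n + (n + n)) * n     ≡⟨ expand n ⟩
        n * n * n + n * n * 2     ≤⟨ +-monoʳ-≤ (n * n * n) (*-monoʳ-≤ (n * n) (≤-trans 2≤a (m≤n*m a K))) ⟩
        n * n * n + n * n * n     ≡⟨ cube K a ⟩
        t * (a * a)               ∎
        where
        open ≤-Reasoning
        expand : ∀ n → (n * n + (n + n)) * n ≡ n * n * n + n * n * 2
        expand = solve-∀
        cube : ∀ K a → let n = K * a in
          n * n * n + n * n * n ≡ 2 * K * K * K * a * (a * a)
        cube = solve-∀

  open ParameterChoice

open Counting
open Sums
open Sublists
open Matchings
open ParameterChoice

open import Defs using (_≤_; _<_; _+_)
open import Data.Integer as ℤ using (+_; +[1+_])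
import Data.Integer.Properties as ℤₚ
open import Data.Rational as ℚ using (ℚ; mkℚ; 0ℚ; 1ℚ; ½; 1/_; _/_; NonNegative; toℚᵘ)
import Data.Rational.Properties as ℚₚ
open import Data.Rational.Solver using (module +-*-Solver)
open import Data.Rational.Unnormalised as ℚᵘ using (mkℚᵘ; *≡*; *≤*)
import Data.Rational.Unnormalised.Properties as ℚᵘₚ

-- Arithmetic of fractions of natural numbers.

module Fractions where

  fraction-cong : ∀ a d b e .{{_ : NonZero d}} .{{_ : NonZero e}} →
    a ℕ.* e ≡ b ℕ.* d → + a / d ≡ + b / e
  fraction-cong a (suc d) b (suc e) eq = ℚₚ.fromℚᵘ-cong {mkℚᵘ (+ a) d} {mkℚᵘ (+ b) e}
    (*≡* (trans (sym (ℤₚ.pos-* a (suc e))) (trans (cong +_ eq) (ℤₚ.pos-* b (suc d)))))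

  toℚᵘ-fraction : ∀ a d → toℚᵘ (+ a / suc d) ℚᵘ.≃ mkℚᵘ (+ a) d
  toℚᵘ-fraction a d = ℚₚ.toℚᵘ-fromℚᵘ (mkℚᵘ (+ a) d)

  fraction-≤ : ∀ a d b e .{{_ : NonZero d}} .{{_ : NonZero e}} →
    a ℕ.* e ℕ.≤ b ℕ.* d → + a / d ℚ.≤ + b / e
  fraction-≤ a (suc d) b (suc e) le = ℚₚ.toℚᵘ-cancel-≤ (begin
    toℚᵘ (+ a / suc d)   ≃⟨ toℚᵘ-fraction a d ⟩
    mkℚᵘ (+ a) d         ≤⟨ *≤* (subst₂ ℤ._≤_ (ℤₚ.pos-* a (suc e)) (ℤₚ.pos-* b (suc d)) (ℤ.+≤+ le)) ⟩
    mkℚᵘ (+ b) e         ≃⟨ ℚᵘₚ.≃-sym (toℚᵘ-fraction b e) ⟩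
    toℚᵘ (+ b / suc e)   ∎)
    where open ℚᵘₚ.≤-Reasoning

  fraction-+ : ∀ a d b e .{{_ : NonZero d}} .{{_ : NonZero e}} .{{_ : NonZero (d ℕ.* e)}} →
    + a / d ℚ.+ + b / e ≡ + (a ℕ.* e ℕ.+ b ℕ.* d) / (d ℕ.* e)
  fraction-+ a (suc d) b (suc e) = ℚₚ.toℚᵘ-injective (begin
    toℚᵘ (+ a / suc d ℚ.+ + b / suc e)
      ≈⟨ ℚₚ.toℚᵘ-homo-+ (+ a / suc d) (+ b / suc e) ⟩
    toℚᵘ (+ a / suc d) ℚᵘ.+ toℚᵘ (+ b / suc e)
      ≈⟨ ℚᵘₚ.+-cong (toℚᵘ-fraction a d) (toℚᵘ-fraction b e) ⟩
    mkℚᵘ (+ a) d ℚᵘ.+ mkℚᵘ (+ b) e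
      ≡⟨ cong (λ i → mkℚᵘ i _) (trans (cong₂ ℤ._+_ (sym (ℤₚ.pos-* a (suc e))) (sym (ℤₚ.pos-* b (suc d)))) (sym (ℤₚ.pos-+ (a ℕ.* suc e) (b ℕ.* suc d)))) ⟩
    mkℚᵘ (+ (a ℕ.* suc e ℕ.+ b ℕ.* suc d)) _
      ≈⟨ ℚᵘₚ.≃-sym (toℚᵘ-fraction (a ℕ.* suc e ℕ.+ b ℕ.* suc d) _) ⟩
    toℚᵘ (+ (a ℕ.* suc e ℕ.+ b ℕ.* suc d) / (suc d ℕ.* suc e)) ∎)
    where open import Relation.Binary.Reasoning.Setoid ℚᵘₚ.≃-setoid

  fraction-* : ∀ a d b e .{{_ : NonZero d}} .{{_ : NonZero e}} .{{_ : NonZero (d ℕ.* e)}} →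
    (+ a / d) ℚ.* (+ b / e) ≡ + (a ℕ.* b) / (d ℕ.* e)
  fraction-* a (suc d) b (suc e) = ℚₚ.toℚᵘ-injective (begin
    toℚᵘ ((+ a / suc d) ℚ.* (+ b / suc e))
      ≈⟨ ℚₚ.toℚᵘ-homo-* (+ a / suc d) (+ b / suc e) ⟩
    toℚᵘ (+ a / suc d) ℚᵘ.* toℚᵘ (+ b / suc e)
      ≈⟨ ℚᵘₚ.*-cong (toℚᵘ-fraction a d) (toℚᵘ-fraction b e) ⟩
    mkℚᵘ (+ a) d ℚᵘ.* mkℚᵘ (+ b) e
      ≡⟨ cong (λ i → mkℚᵘ i _) (sym (ℤₚ.pos-* a b)) ⟩
    mkℚᵘ (+ (a ℕ.* b)) _
      ≈⟨ ℚᵘₚ.≃-sym (toℚᵘ-fraction (a ℕ.* b) _) ⟩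
    toℚᵘ (+ (a ℕ.* b) / (suc d ℕ.* suc e)) ∎)
    where open import Relation.Binary.Reasoning.Setoid ℚᵘₚ.≃-setoid

  fraction-+-same : ∀ a b d .{{_ : NonZero d}} → + a / d ℚ.+ + b / d ≡ + (a ℕ.+ b) / d
  fraction-+-same a b d@(suc _) = trans (fraction-+ a d b d)
    (fraction-cong (a ℕ.* d ℕ.+ b ℕ.* d) (d ℕ.* d) (a ℕ.+ b) d (rearrange a b d))
    where
    rearrange : ∀ a b d → (a ℕ.* d ℕ.+ b ℕ.* d) ℕ.* d ≡ (a ℕ.+ b) ℕ.* (d ℕ.* d)
    rearrange = solve-∀

open Fractions

-- Order and linear combinations of Cauchy reals.

module Reals where

  open ℚₚ.≤-Reasoning
  open +-*-Solver using (solve; _:=_; _:+_; _:-_; _:*_; con)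

  p≤p+δ : ∀ p {δ} → 0ℚ ℚ.< δ → p ℚ.≤ p ℚ.+ δ
  p≤p+δ p 0<δ = subst (ℚ._≤ p ℚ.+ _) (ℚₚ.+-identityʳ p) (ℚₚ.+-monoʳ-≤ p (ℚₚ.<⇒≤ 0<δ))

  scale-pos : ∀ k .{{_ : ℚ.Positive k}} {δ} → 0ℚ ℚ.< δ → 0ℚ ℚ.< k ℚ.* δ
  scale-pos k {δ} 0<δ = subst (ℚ._< k ℚ.* δ) (ℚₚ.*-zeroʳ k) (ℚₚ.*-monoʳ-<-pos k 0<δ)

  pointwise⇒≤ : ∀ x y → (∀ n → seq x n ℚ.≤ seq y n) → x ≤ y
  pointwise⇒≤ x y h δ 0<δ = 0 , λ n _ → ℚₚ.≤-trans (h n) (p≤p+δ (seq y n) 0<δ)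

  pointwise-≡⇒≤ : ∀ x y → (∀ n → seq x n ≡ seq y n) → x ≤ y
  pointwise-≡⇒≤ x y h = pointwise⇒≤ x y (ℚₚ.≤-reflexive ∘ h)

  halves : ∀ z δ → (z ℚ.+ ½ ℚ.* δ) ℚ.+ ½ ℚ.* δ ≡ z ℚ.+ δ
  halves = solve 2 (λ z δ → (z :+ con ½ :* δ) :+ con ½ :* δ := z :+ δ) refl

  ≤-trans : ∀ x y z → x ≤ y → y ≤ z → x ≤ z
  ≤-trans x y z x≤y y≤z δ 0<δ =
    let M , h = x≤y (½ ℚ.* δ) (scale-pos ½ 0<δ)
        N , k = y≤z (½ ℚ.* δ) (scale-pos ½ 0<δ)
    in M ℕ.⊔ N , λ n n≥ → begin
      seq x n                               ≤⟨ h n (ℕₚ.m⊔n≤o⇒m≤o M N n≥) ⟩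
      seq y n ℚ.+ ½ ℚ.* δ                   ≤⟨ ℚₚ.+-monoˡ-≤ (½ ℚ.* δ) (k n (ℕₚ.m⊔n≤o⇒n≤o M N n≥)) ⟩
      (seq z n ℚ.+ ½ ℚ.* δ) ℚ.+ ½ ℚ.* δ     ≡⟨ halves (seq z n) δ ⟩
      seq z n ℚ.+ δ                         ∎

  +-mono-≤ : ∀ x x′ y y′ → x ≤ x′ → y ≤ y′ → x + y ≤ x′ + y′
  +-mono-≤ x x′ y y′ x≤ y≤ δ 0<δ =
    let M , h = x≤ (½ ℚ.* δ) (scale-pos ½ 0<δ)
        N , k = y≤ (½ ℚ.* δ) (scale-pos ½ 0<δ)
    in M ℕ.⊔ N , λ n n≥ → begin
      seq x n ℚ.+ seq y n
        ≤⟨ ℚₚ.+-mono-≤ (h n (ℕₚ.m⊔n≤o⇒m≤o M N n≥)) (k n (ℕₚ.m⊔n≤o⇒n≤o M N n≥)) ⟩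
      (seq x′ n ℚ.+ ½ ℚ.* δ) ℚ.+ (seq y′ n ℚ.+ ½ ℚ.* δ)
        ≡⟨ solve 3 (λ a b δ → (a :+ con ½ :* δ) :+ (b :+ con ½ :* δ) := (a :+ b) :+ δ) refl (seq x′ n) (seq y′ n) δ ⟩
      (seq x′ n ℚ.+ seq y′ n) ℚ.+ δ ∎

  ·-monoʳ-≤ : ∀ q .{{_ : NonNegative q}} x y → x ≤ y → q · x ≤ q · y
  ·-monoʳ-≤ q x y x≤y δ 0<δ =
    -- The tolerance is `δ / (q + 1)`; the added 1 keeps the divisor positive when `q` is 0.
    let N , h = x≤y (r ℚ.* δ) 0<rδ
    in N , λ n n≥ → begin
      q ℚ.* seq x n                        ≤⟨ ℚₚ.*-monoˡ-≤-nonNeg q (h n n≥) ⟩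
      q ℚ.* (seq y n ℚ.+ r ℚ.* δ)          ≡⟨ ℚₚ.*-distribˡ-+ q (seq y n) (r ℚ.* δ) ⟩
      q ℚ.* seq y n ℚ.+ q ℚ.* (r ℚ.* δ)    ≤⟨ ℚₚ.+-monoʳ-≤ (q ℚ.* seq y n) qrδ≤δ ⟩
      q ℚ.* seq y n ℚ.+ δ                  ∎
    where
    instance
      q+1-pos : ℚ.Positive (q ℚ.+ 1ℚ)
      q+1-pos = ℚₚ.nonNeg+pos⇒pos q 1ℚ
      q+1≢0 : ℚ.NonZero (q ℚ.+ 1ℚ)
      q+1≢0 = ℚₚ.pos⇒nonZero (q ℚ.+ 1ℚ)
    r : ℚ
    r = 1/ (q ℚ.+ 1ℚ)
    instance
      r-pos : ℚ.Positive r
      r-pos = ℚₚ.1/pos⇒pos (q ℚ.+ 1ℚ)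
    0<rδ : 0ℚ ℚ.< r ℚ.* δ
    0<rδ = scale-pos r 0<δ
    qrδ≤δ : q ℚ.* (r ℚ.* δ) ℚ.≤ δ
    qrδ≤δ = begin
      q ℚ.* (r ℚ.* δ)                       ≤⟨ p≤p+δ (q ℚ.* (r ℚ.* δ)) 0<rδ ⟩
      q ℚ.* (r ℚ.* δ) ℚ.+ r ℚ.* δ           ≡⟨ solve 3 (λ q r δ → q :* (r :* δ) :+ r :* δ := ((q :+ con 1ℚ) :* r) :* δ) refl q r δ ⟩
      ((q ℚ.+ 1ℚ) ℚ.* r) ℚ.* δ              ≡⟨ cong (ℚ._* δ) (ℚₚ.*-inverseʳ (q ℚ.+ 1ℚ)) ⟩
      1ℚ ℚ.* δ                              ≡⟨ ℚₚ.*-identityˡ δ ⟩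
      δ                                     ∎

  p≤q⇒0≤q-p : ∀ {p q} → p ℚ.≤ q → NonNegative (q ℚ.- p)
  p≤q⇒0≤q-p {p} {q} p≤q = ℚ.nonNegative (subst (ℚ._≤ q ℚ.- p) (ℚₚ.+-inverseʳ p) (ℚₚ.+-monoˡ-≤ (ℚ.- p) p≤q))

  -- Individual approximants of `x` may be negative, so the factors cannot be compared term by term.
  -- Instead `0ℝ ≤ x` is scaled by `q - p` and `p · x` is added.
  ·-monoˡ-≤ : ∀ {p q} x → 0ℝ ≤ x → p ℚ.≤ q → p · x ≤ q · x
  ·-monoˡ-≤ {p} {q} x 0≤x p≤q δ 0<δ =
    let N , h = ·-monoʳ-≤ (q ℚ.- p) {{p≤q⇒0≤q-p p≤q}} 0ℝ x 0≤x δ 0<δ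
    in N , λ n n≥ → begin
      p ℚ.* seq x n
        ≡⟨ solve 3 (λ p q x → p :* x := (q :- p) :* con 0ℚ :+ p :* x) refl p q (seq x n) ⟩
      (q ℚ.- p) ℚ.* 0ℚ ℚ.+ p ℚ.* seq x n
        ≤⟨ ℚₚ.+-monoˡ-≤ (p ℚ.* seq x n) (h n n≥) ⟩
      ((q ℚ.- p) ℚ.* seq x n ℚ.+ δ) ℚ.+ p ℚ.* seq x n
        ≡⟨ solve 4 (λ p q x δ → ((q :- p) :* x :+ δ) :+ p :* x := q :* x :+ δ) refl p q (seq x n) δ ⟩
      q ℚ.* seq x n ℚ.+ δ ∎

  Σℝ-mono-≤ : ∀ {k} (x y : Vector ℝ k) → (∀ i → x i ≤ y i) → Σℝ x ≤ Σℝ y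
  Σℝ-mono-≤ {zero}  x y h = pointwise-≡⇒≤ 0ℝ 0ℝ λ _ → refl
  Σℝ-mono-≤ {suc k} x y h = +-mono-≤ (x zero) (y zero) (Σℝ (tail x)) (Σℝ (tail y))
    (h zero) (Σℝ-mono-≤ (tail x) (tail y) (h ∘ suc))

  Σℝ-distrib-+ : ∀ {k} (f g : Vector ℚ k) (x : Vector ℝ k) n →
    seq (Σℝ λ i → f i · x i) n ℚ.+ seq (Σℝ λ i → g i · x i) n ≡
    seq (Σℝ λ i → (f i ℚ.+ g i) · x i) n
  Σℝ-distrib-+ {zero}  f g x n = refl
  Σℝ-distrib-+ {suc k} f g x n = trans
    (solve 5 (λ f g x s t → (f :* x :+ s) :+ (g :* x :+ t) := (f :+ g) :* x :+ (s :+ t)) refl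
      (f zero) (g zero) (seq (x zero) n) (seq (Σℝ λ i → f (suc i) · x (suc i)) n) (seq (Σℝ λ i → g (suc i) · x (suc i)) n))
    (cong ((f zero ℚ.+ g zero) ℚ.* seq (x zero) n ℚ.+_) (Σℝ-distrib-+ (tail f) (tail g) (tail x) n))

  Σℝ-distribˡ-· : ∀ {k} q (x : Vector ℝ k) n →
    seq (Σℝ λ i → q · x i) n ≡ q ℚ.* seq (Σℝ x) n
  Σℝ-distribˡ-· {zero}  q x n = sym (ℚₚ.*-zeroʳ q)
  Σℝ-distribˡ-· {suc k} q x n = trans
    (cong (q ℚ.* seq (x zero) n ℚ.+_) (Σℝ-distribˡ-· q (tail x) n))
    (sym (ℚₚ.*-distribˡ-+ q (seq (x zero) n) (seq (Σℝ (tail x)) n)))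

open Reals

-- Averaging over instances: the easy half of Yao's principle.

module Minimax {l r : ℕ} where

  _/!_ : ℕ → ℕ → ℚ
  a /! t = (+ a ℚ./ (t ℕ.!)) {{t ℕₚ.!≢0}}

  mean : DeterministicAlgorithm l r → List (Edge l r) → ℚ
  mean D σ = ∑ (permutations σ) (outputSize D) /! length σ

  ∑ℚ : List (List (Edge l r)) → (List (Edge l r) → ℚ) → ℚ
  ∑ℚ σs f = foldr (λ σ s → f σ ℚ.+ s) 0ℚ σs

  ∑ℚ-++ : ∀ σs τs f → ∑ℚ (σs ++ τs) f ≡ ∑ℚ σs f ℚ.+ ∑ℚ τs f
  ∑ℚ-++ []       τs f = sym (ℚₚ.+-identityˡ _)
  ∑ℚ-++ (σ ∷ σs) τs f = trans (cong (f σ ℚ.+_) (∑ℚ-++ σs τs f)) (sym (ℚₚ.+-assoc (f σ) _ _))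

  ∑ℚ-mean : ∀ D t σs → (∀ {σ} → σ ∈ σs → length σ ≡ t) →
    ∑ℚ σs (mean D) ≡ (∑[ σ ∈ σs ] ∑ (permutations σ) (outputSize D)) /! t
  ∑ℚ-mean D t []       h = sym (ℚₚ.0/n≡0 (t ℕ.!) {{t ℕₚ.!≢0}})
  ∑ℚ-mean D t (σ ∷ σs) h = trans
    (cong₂ ℚ._+_ (cong (∑ (permutations σ) (outputSize D) /!_) (h (here refl))) (∑ℚ-mean D t σs (h ∘ there)))
    (fraction-+-same (∑ (permutations σ) (outputSize D)) _ (t ℕ.!) {{t ℕₚ.!≢0}})

  module _ (A : RandomizedAlgorithm) where

    mixture : (DeterministicAlgorithm l r → ℚ) → ℝ
    mixture f = Σℝ λ i → f (strategy (A l r) i) · probability (A l r) i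

    -- An average over the coins is at most any common bound, since the probabilities are
    -- non-negative and sum to 1.
    mixture-≤ : ∀ f q .{{_ : NonNegative q}} → (∀ D → f D ℚ.≤ q) → mixture f ≤ fromℚ q
    mixture-≤ f q f≤q =
      ≤-trans (mixture f) (Σℝ λ i → q · p i) (fromℚ q)
        (Σℝ-mono-≤ _ _ λ i → ·-monoˡ-≤ (p i) (nonNegative (A l r) i) (f≤q _))
        (≤-trans (Σℝ λ i → q · p i) (q · Σℝ p) (fromℚ q)
          (pointwise-≡⇒≤ (Σℝ λ i → q · p i) (q · Σℝ p) (Σℝ-distribˡ-· q p))
          (≤-trans (q · Σℝ p) (q · 1ℝ) (fromℚ q)
            (·-monoʳ-≤ q (Σℝ p) 1ℝ (proj₁ (total (A l r))))
            (pointwise-≡⇒≤ (q · 1ℝ) (fromℚ q) λ _ → ℚₚ.*-identityʳ q)))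
      where
      p = probability (A l r)

    module _ (c : ℝ) (c≤ratio : ∀ (G : BipartiteGraph l r) .{{_ : NonZero (∣OPT∣ G)}} → c ≤ ratio A G) where

      -- The assumed lower bound on the ratio of the graph with edges `σ`, cleared of its
      -- denominator so that different graphs can be added up.
      optimum·c≤ : ∀ {σ} → Unique σ → 1 ℕ.≤ optimum σ →
        (+ optimum σ / 1) · c ≤ mixture (λ D → mean D σ)
      optimum·c≤ {σ} u 1≤o =
        ≤-trans (q · c) (q · ratio A G) (expectedSize A G)
          (·-monoʳ-≤ q c (ratio A G) (c≤ratio G))
          (pointwise-≡⇒≤ (q · ratio A G) (expectedSize A G) λ n →
            trans (sym (ℚₚ.*-assoc q (+ 1 / optimum σ) (seq (expectedSize A G) n)))
            (trans (cong (ℚ._* seq (expectedSize A G) n) q*1/q)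
                   (ℚₚ.*-identityˡ (seq (expectedSize A G) n))))
        where
        G : BipartiteGraph l r
        G = record { edges = σ ; distinct = u }
        instance
          o≢0 : NonZero (optimum σ)
          o≢0 = ℕ.>-nonZero 1≤o
          1*o≢0 : NonZero (1 ℕ.* optimum σ)
          1*o≢0 = ℕₚ.m*n≢0 1 (optimum σ)
        q : ℚ
        q = + optimum σ / 1
        instance
          q-nonNeg : NonNegative q
          q-nonNeg = ℚₚ.normalize-nonNeg (optimum σ) 1
        q*1/q : q ℚ.* (+ 1 / optimum σ) ≡ 1ℚ
        q*1/q = trans (fraction-* (optimum σ) 1 1 (optimum σ))
          (fraction-cong (optimum σ ℕ.* 1) (1 ℕ.* optimum σ) 1 1 (rearrange (optimum σ)))
          where
          rearrange : ∀ o → o ℕ.* 1 ℕ.* 1 ≡ 1 ℕ.* (1 ℕ.* o)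
          rearrange = solve-∀

      ∑optimum·c≤ : ∀ σs → (∀ {σ} → σ ∈ σs → Unique σ × 1 ℕ.≤ optimum σ) →
        (+ ∑ σs optimum / 1) · c ≤ mixture (λ D → ∑ℚ σs (mean D))
      ∑optimum·c≤ [] h = pointwise-≡⇒≤ (0ℚ · c) (mixture λ _ → 0ℚ) λ n →
        trans (ℚₚ.*-zeroˡ (seq c n)) (sym (trans (Σℝ-distribˡ-· 0ℚ (probability (A l r)) n) (ℚₚ.*-zeroˡ (seq (Σℝ (probability (A l r))) n))))
      ∑optimum·c≤ (σ ∷ σs) h =
        ≤-trans ((+ ∑ (σ ∷ σs) optimum / 1) · c) (o · c + O · c) (mixture (λ D → ∑ℚ (σ ∷ σs) (mean D)))
          (pointwise-≡⇒≤ ((+ ∑ (σ ∷ σs) optimum / 1) · c) (o · c + O · c) λ n →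
            trans (cong (ℚ._* seq c n) (sym (fraction-+-same (optimum σ) (∑ σs optimum) 1)))
                  (ℚₚ.*-distribʳ-+ (seq c n) o O))
          (≤-trans (o · c + O · c) (mixture f + mixture g) (mixture (λ D → ∑ℚ (σ ∷ σs) (mean D)))
            (+-mono-≤ (o · c) (mixture f) (O · c) (mixture g)
              (optimum·c≤ (proj₁ (h (here refl))) (proj₂ (h (here refl))))
              (∑optimum·c≤ σs (h ∘ there)))
            (pointwise-≡⇒≤ (mixture f + mixture g) (mixture (λ D → ∑ℚ (σ ∷ σs) (mean D)))
              (Σℝ-distrib-+ (f ∘ strategy (A l r)) (g ∘ strategy (A l r)) (probability (A l r)))))
        where
        o O : ℚ
        o = + optimum σ / 1
        O = + ∑ σs optimum / 1
        f g : DeterministicAlgorithm l r → ℚ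
        f D = mean D σ
        g D = ∑ℚ σs (mean D)

      -- Summed over the instances, `c` times the total optimum is at most the expected total
      -- output, which is at most `L` times the total optimum by the bound for each deterministic
      -- algorithm. The positive total optimum then cancels. Comparing totals instead of single
      -- ratios weights each instance by its optimum.
      minimax : ∀ L .{{_ : NonNegative L}} σs → (∀ {σ} → σ ∈ σs → Unique σ × 1 ℕ.≤ optimum σ) →
        1 ℕ.≤ ∑ σs optimum →
        (∀ D → ∑ℚ σs (mean D) ℚ.≤ L ℚ.* (+ ∑ σs optimum / 1)) → c ≤ fromℚ L
      minimax L σs h 1≤O bound =
        ≤-trans c (q⁻¹ · (q · c)) (fromℚ L)
          (pointwise-≡⇒≤ c (q⁻¹ · (q · c)) λ n →
            sym (trans (sym (ℚₚ.*-assoc q⁻¹ q (seq c n)))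
                (trans (cong (ℚ._* seq c n) (ℚₚ.*-inverseˡ q)) (ℚₚ.*-identityˡ (seq c n)))))
          (≤-trans (q⁻¹ · (q · c)) (q⁻¹ · fromℚ (L ℚ.* q)) (fromℚ L)
            (·-monoʳ-≤ q⁻¹ (q · c) (fromℚ (L ℚ.* q))
              (≤-trans (q · c) (mixture (λ D → ∑ℚ σs (mean D))) (fromℚ (L ℚ.* q))
                (∑optimum·c≤ σs h) (mixture-≤ _ (L ℚ.* q) bound)))
            (pointwise-≡⇒≤ (q⁻¹ · fromℚ (L ℚ.* q)) (fromℚ L) λ n →
              trans (cong (q⁻¹ ℚ.*_) (ℚₚ.*-comm L q))
              (trans (sym (ℚₚ.*-assoc q⁻¹ q L))
              (trans (cong (ℚ._* L) (ℚₚ.*-inverseˡ q)) (ℚₚ.*-identityˡ L)))))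
        where
        q : ℚ
        q = + ∑ σs optimum / 1
        instance
          O≢0 : NonZero (∑ σs optimum)
          O≢0 = ℕ.>-nonZero 1≤O
          q-pos : ℚ.Positive q
          q-pos = ℚₚ.normalize-pos (∑ σs optimum) 1
          q≢0 : ℚ.NonZero q
          q≢0 = ℚₚ.pos⇒nonZero q
          q-nonNeg : NonNegative q
          q-nonNeg = ℚₚ.pos⇒nonNeg q
          L*q-nonNeg : NonNegative (L ℚ.* q)
          L*q-nonNeg = ℚₚ.nonNeg*nonNeg⇒nonNeg L q
        q⁻¹ : ℚ
        q⁻¹ = 1/ q
        instance
          q⁻¹-pos : ℚ.Positive q⁻¹
          q⁻¹-pos = ℚₚ.1/pos⇒pos q
          q⁻¹-nonNeg : NonNegative q⁻¹
          q⁻¹-nonNeg = ℚₚ.pos⇒nonNeg q⁻¹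

-- The bound from the thick Z, and its limit 2/3.

module Bound (A : RandomizedAlgorithm) (c : ℝ)
  (c≤ratio : ∀ {l r} (G : BipartiteGraph l r) .{{_ : NonZero (∣OPT∣ G)}} → c ≤ ratio A G) where

  -- The instances are all prefixes and all full orders, each read as the edge list of a graph.
  parameters-bound : ∀ {k} → Parameters k → c ≤ fromℚ (+ (2 ℕ.* suc k ℕ.+ 6) / (3 ℕ.* suc k))
  parameters-bound {k} P =
    minimax A c c≤ratio L {{ℚₚ.normalize-nonNeg (2 ℕ.* suc k ℕ.+ 6) (3 ℕ.* suc k)}}
      (prefixes ++ Seq (d ℕ.+ t)) admissible some-optimum bound
    where
    open Parameters P
    open ThickZ n
    open Tradeoff n a k t n≡Ka 0<a 0<t
      (subst (suc k ℕ.* t ℕ.+ t ℕ.≤_) (sym length-thickZ) few-pendants)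
      (subst (λ m → m ℕ.* n ℕ.≤ t ℕ.* (a ℕ.* a)) (sym length-thickZ) long-prefix)
    open Minimax {n ℕ.+ n} {n ℕ.+ n}
    L : ℚ
    L = + (2 ℕ.* K ℕ.+ 6) / (3 ℕ.* K)
    0<d+t : 0 ℕ.< d ℕ.+ t
    0<d+t = ℕₚ.≤-trans 0<t (ℕₚ.m≤n+m t d)
    full : List (List (Edge (n ℕ.+ n) (n ℕ.+ n)))
    full = Seq (d ℕ.+ t)
    admissible : ∀ {σ} → σ ∈ prefixes ++ full → Unique σ × 1 ℕ.≤ optimum σ
    admissible σ∈ with ∈-++⁻ prefixes σ∈
    ... | inj₁ σ∈ˡ = unique (Seq⇒IsArrangement t (prefix∈Seq σ∈ˡ)) , optimum-pos t 0<t (prefix∈Seq σ∈ˡ)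
    ... | inj₂ σ∈ʳ = unique (Seq⇒IsArrangement (d ℕ.+ t) σ∈ʳ) , optimum-pos (d ℕ.+ t) 0<d+t σ∈ʳ
    OPT : ℕ
    OPT = ∑ prefixes optimum ℕ.+ ∑ full optimum
    OPT≡ : ∑ (prefixes ++ full) optimum ≡ OPT
    OPT≡ = ∑-++ optimum prefixes full
    some-optimum : 1 ℕ.≤ ∑ (prefixes ++ full) optimum
    some-optimum = subst (1 ℕ.≤_) (sym OPT≡) total-optimum-pos
    module _ (D : DeterministicAlgorithm (n ℕ.+ n) (n ℕ.+ n)) where
      out : ℕ
      out = ∑ prefixes (outputSize D) ℕ.+ ∑ full (outputSize D)
      cancel-! : ∀ s x y → x ≡ s ℕ.! ℕ.* y → x /! s ≡ + y / 1
      cancel-! s x y eq = fraction-cong x (s ℕ.!) y 1 {{s ℕₚ.!≢0}}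
        (trans (cong (ℕ._* 1) eq) (trans (ℕₚ.*-identityʳ _) (ℕₚ.*-comm (s ℕ.!) y)))
      swap-factors : ∀ x y z → x ℕ.* (y ℕ.* z) ≡ y ℕ.* (x ℕ.* z)
      swap-factors = solve-∀
      -- As an instance of its own, a prefix is presented in a fresh random order. Over all prefixes
      -- this reshuffling changes nothing, by `∑-permutations`.
      prefixes-mean : ∑ℚ prefixes (mean D) ≡ + ∑ prefixes (outputSize D) / 1
      prefixes-mean = trans (∑ℚ-mean D t prefixes λ σ∈ → size (Seq⇒IsArrangement t (prefix∈Seq σ∈)))
        (cancel-! t (∑[ σ ∈ prefixes ] ∑ (permutations σ) (outputSize D)) (∑ prefixes (outputSize D))
          (trans (∑-prefixes _)
          (trans (cong (w ℕ.*_) (∑-permutations t (outputSize D)))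
          (trans (swap-factors w (t ℕ.!) _) (cong (t ℕ.! ℕ.*_) (sym (∑-prefixes (outputSize D))))))))
      full-mean : ∑ℚ full (mean D) ≡ + ∑ full (outputSize D) / 1
      full-mean = trans (∑ℚ-mean D (d ℕ.+ t) full λ σ∈ → size (Seq⇒IsArrangement (d ℕ.+ t) σ∈))
        (cancel-! (d ℕ.+ t) (∑[ σ ∈ full ] ∑ (permutations σ) (outputSize D)) (∑ full (outputSize D))
          (∑-permutations (d ℕ.+ t) (outputSize D)))
      total-mean : ∑ℚ (prefixes ++ full) (mean D) ≡ + out / 1
      total-mean = trans (∑ℚ-++ prefixes full (mean D))
        (trans (cong₂ ℚ._+_ prefixes-mean full-mean)
               (fraction-+-same (∑ prefixes (outputSize D)) (∑ full (outputSize D)) 1))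
      bound : ∑ℚ (prefixes ++ full) (mean D) ℚ.≤ L ℚ.* (+ ∑ (prefixes ++ full) optimum / 1)
      bound = begin
        ∑ℚ (prefixes ++ full) (mean D)
          ≡⟨ total-mean ⟩
        + out / 1
          ≤⟨ fraction-≤ out 1 ((2 ℕ.* K ℕ.+ 6) ℕ.* OPT) (3 ℕ.* K ℕ.* 1) cross ⟩
        + ((2 ℕ.* K ℕ.+ 6) ℕ.* OPT) / (3 ℕ.* K ℕ.* 1)
          ≡⟨ sym (fraction-* (2 ℕ.* K ℕ.+ 6) (3 ℕ.* K) OPT 1) ⟩
        L ℚ.* (+ OPT / 1)
          ≡⟨ cong (λ o → L ℚ.* (+ o / 1)) (sym OPT≡) ⟩
        L ℚ.* (+ ∑ (prefixes ++ full) optimum / 1) ∎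
        where
        open ℚₚ.≤-Reasoning
        cross : out ℕ.* (3 ℕ.* K ℕ.* 1) ℕ.≤ (2 ℕ.* K ℕ.+ 6) ℕ.* OPT ℕ.* 1
        cross = subst₂ ℕ._≤_
          (trans (ℕₚ.*-comm (3 ℕ.* K) out) (cong (out ℕ.*_) (sym (ℕₚ.*-identityʳ (3 ℕ.* K)))))
          (sym (ℕₚ.*-identityʳ ((2 ℕ.* K ℕ.+ 6) ℕ.* OPT)))
          (tradeoff D)

  -- Abstract because unfolding it in theorem7 is prohibitively expensive.
  abstract
    c≤2/3+2/K : ∀ k → c ≤ fromℚ (+ (2 ℕ.* suc k ℕ.+ 6) / (3 ℕ.* suc k))
    c≤2/3+2/K k = parameters-bound (parameters k)

-- With q the denominator of δ, K = 2q makes 2/3 + 2/K = 2/3 + 1/q ≤ 2/3 + δ.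
archimedean : ∀ δ → 0ℚ ℚ.< δ → ∃[ k ]
  + (2 ℕ.* suc k ℕ.+ 6) / (3 ℕ.* suc k) ℚ.≤ + 2 / 3 ℚ.+ δ
archimedean δ 0<δ = go δ (ℚ.positive 0<δ)
  where
  go : ∀ δ → ℚ.Positive δ → ∃[ k ]
    + (2 ℕ.* suc k ℕ.+ 6) / (3 ℕ.* suc k) ℚ.≤ + 2 / 3 ℚ.+ δ
  go δ@(mkℚ +[1+ p ] q-1 _) _ = ℕ.pred (2 ℕ.* q) , (begin
    + (2 ℕ.* (2 ℕ.* q) ℕ.+ 6) / (3 ℕ.* (2 ℕ.* q))
      ≤⟨ fraction-≤ (2 ℕ.* (2 ℕ.* q) ℕ.+ 6) (3 ℕ.* (2 ℕ.* q)) (2 ℕ.* q ℕ.+ suc p ℕ.* 3) (3 ℕ.* q) cross ⟩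
    + (2 ℕ.* q ℕ.+ suc p ℕ.* 3) / (3 ℕ.* q)
      ≡⟨ sym (fraction-+ 2 3 (suc p) q) ⟩
    + 2 / 3 ℚ.+ + suc p / q
      ≡⟨ cong (+ 2 / 3 ℚ.+_) (ℚₚ.↥p/↧p≡p δ) ⟩
    + 2 / 3 ℚ.+ δ ∎)
    where
    open ℚₚ.≤-Reasoning
    q = suc q-1
    cross : (2 ℕ.* (2 ℕ.* q) ℕ.+ 6) ℕ.* (3 ℕ.* q) ℕ.≤ (2 ℕ.* q ℕ.+ suc p ℕ.* 3) ℕ.* (3 ℕ.* (2 ℕ.* q))
    cross = ℕₚ.m+n≤o⇒m≤o ((2 ℕ.* (2 ℕ.* q) ℕ.+ 6) ℕ.* (3 ℕ.* q)) (ℕₚ.≤-reflexive (slack p q))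
      where
      slack : ∀ p q → (2 ℕ.* (2 ℕ.* q) ℕ.+ 6) ℕ.* (3 ℕ.* q) ℕ.+ 18 ℕ.* p ℕ.* q ≡
                      (2 ℕ.* q ℕ.+ suc p ℕ.* 3) ℕ.* (3 ℕ.* (2 ℕ.* q))
      slack = solve-∀

theorem7 : ∀ (ε : ℝ) → 0ℝ < ε → (A : RandomizedAlgorithm) →
    CompetitiveRatio A AtMost (fromℚ (+ 2 / 3) + ε)
theorem7 ε (δ , 0<δ , N , δ≤ε) A c c≤ratio η 0<η =
  -- `δ` is the rational gap witnessing `0ℝ < ε`: from index `N` on, the approximants of `ε` are at
  -- least `δ`, so a bound `L` of at most 2/3 + `δ` suffices.
  let k , L≤ = archimedean δ 0<δ
      L = + (2 ℕ.* suc k ℕ.+ 6) / (3 ℕ.* suc k)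
      M , c≤L = Bound.c≤2/3+2/K A c c≤ratio k η 0<η
  in M ℕ.⊔ N , λ n n≥ → begin
    seq c n                             ≤⟨ c≤L n (ℕₚ.m⊔n≤o⇒m≤o M N n≥) ⟩
    L ℚ.+ η                             ≤⟨ ℚₚ.+-monoˡ-≤ η L≤ ⟩
    (+ 2 / 3 ℚ.+ δ) ℚ.+ η               ≤⟨ ℚₚ.+-monoˡ-≤ η (ℚₚ.+-monoʳ-≤ (+ 2 / 3) (subst (ℚ._≤ seq ε n) (ℚₚ.+-identityˡ δ) (δ≤ε n (ℕₚ.m⊔n≤o⇒n≤o M N n≥)))) ⟩
    (+ 2 / 3 ℚ.+ seq ε n) ℚ.+ η         ∎
  where open ℚₚ.≤-Reasoning
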